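{- Let $k$ be a positive integer and $T$ a string of length $n$. The total number of (maximal) uniform $k$-runs in $T$, over all periods $\ell\in[1\mathinner{.\,.}\lfloor n/2\rfloor]$, is $\mathcal{O}(nk\log k)$.
   Context: $T[i\mathinner{.\,.} j)=T[i]\cdots T[j-1]$, positions numbered from 1. A uniform $k$-run of period $\ell$ is a substring $T[a\mathinner{.\,.} b)$ with $b-a\ge 2\ell$ such that the sets $\{j\in[i\mathinner{.\,.} i+\ell): T[j]\ne T[j+\ell]\}$ for all $i\in[a\mathinner{.\,.} b-2\ell]$ have cardinality at most $k$ and are all equal; it is maximal if it cannot be extended to the left or to the right by a position while remaining a uniform $k$-run of period $\ell$. A uniform $k$-run is identified by the triple $(a,b,\ell)$. -}

module Defs where

open import Data.Nat using (ℕ; suc; _+_; _*_; _∸_; _≤_; _<_)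
open import Data.Nat.DivMod using (_/_)
open import Data.Nat.Logarithm using (⌊log₂_⌋)
open import Data.List using (List; length)
open import Data.List.Relation.Unary.All using (All)
open import Data.List.Relation.Unary.Unique.Propositional using (Unique)
open import Data.Product using (_×_; _,_)
open import Relation.Binary.PropositionalEquality using (_≢_)
open import Relation.Nullary using (¬_)

-- A string of length n over alphabet A is modelled as T : ℕ → A where only
-- positions 1 .. n are meaningful (positions are numbered from 1).  All
-- notions below only inspect positions inside [1 .. n].

module _ {A : Set} (T : ℕ → A) where

  Mismatch : (ℓ i j : ℕ) → Set
  Mismatch ℓ i j = (i ≤ j) × (j < i + ℓ) × (T j ≢ T (j + ℓ))

  AtMost : ℕ → (ℕ → Set) → Set
  AtMost k P = (js : List ℕ) → Unique js → All P js → length js ≤ k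

  -- (a, b, ℓ) is a uniform k-run of period ℓ in T (of length n):
  -- T[a .. b) is a substring, b - a ≥ 2ℓ, and the mismatch sets for all
  -- i ∈ [a .. b - 2ℓ] have cardinality ≤ k and are all equal.
  IsUniformRun : (k n a b ℓ : ℕ) → Set
  IsUniformRun k n a b ℓ =
    (1 ≤ a) × (a ≤ b) × (b ≤ suc n) × (2 * ℓ ≤ b ∸ a) ×
    ((i : ℕ) → a ≤ i → i ≤ b ∸ 2 * ℓ → AtMost k (Mismatch ℓ i)) ×
    ((i i′ : ℕ) → a ≤ i → i ≤ b ∸ 2 * ℓ → a ≤ i′ → i′ ≤ b ∸ 2 * ℓ →
       (j : ℕ) → Mismatch ℓ i j → Mismatch ℓ i′ j)

  -- maximal: cannot be extended by one position to the left or to the right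
  -- (the bounds 1 ≤ a and b ≤ n+1 inside IsUniformRun ensure the extension
  -- stays within the string)
  IsMaximalUniformRun : (k n a b ℓ : ℕ) → Set
  IsMaximalUniformRun k n a b ℓ =
    IsUniformRun k n a b ℓ ×
    ¬ IsUniformRun k n (a ∸ 1) b ℓ ×
    ¬ IsUniformRun k n a (suc b) ℓ

  Counted : (k n : ℕ) → ℕ × ℕ × ℕ → Set
  Counted k n (a , b , ℓ) =
    (1 ≤ ℓ) × (ℓ ≤ n / 2) × IsMaximalUniformRun k n a b ℓ

-- log factor: 1 + ⌊log₂ k⌋ (so that the bound is meaningful at k = 1)
logFactor : ℕ → ℕ
logFactor k = suc ⌊log₂ k ⌋

{-# OPTIONS --safe #-}
module Submission where

-- Call x an ℓ-mismatch if T[x] ≠ T[x+ℓ].  A maximal uniform run (a , b , ℓ) is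
-- determined by (a , ℓ), and a = 1 or one of a-1, a-1+ℓ is an ℓ-mismatch m; by
-- reversing the string, the second kind of mismatch reduces to the first.  So
-- it suffices to count the pairs (ℓ , m) for which m is an ℓ-mismatch and
-- [m , m+ℓ) contains at most K = k+1 of them.
--
-- The ℓ-mismatches of such a window cut it into at most K gaps of total length
-- ℓ.  Give the gap after a mismatch q the weight ∑ 2^(J-j) over all j ≤ J for
-- which it has length at least ℓ/2^j, where 2^J ≥ 2K.  Then each window has
-- weight at least 2^J/2, while each mismatch lies in at most K windows.  Hence
-- the count is at most 2K ∑_j 2^(-j) |R_j|, where R_j is the set of left-maximal
-- gapped repeats of period ℓ with arms of length about ℓ/2^j.
--
-- It remains to see that |R_j| = O(2^j n), so that each of the O(log k) values
-- of j contributes O(kn).  Repeats with arms of length about 8h are injectively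
-- encoded by their position and period rounded to multiples of h, unless their
-- arms have a period below h: two repeats with the same code and with periods
-- ℓ < ℓ+d make d a period of an arm.  If the least period p of the arms is
-- small, one of the arms starts where a p-periodic run starts, and for a given
-- run the periods ℓ are at least p apart.  The runs with p in [2^a , 2^(a+1))
-- hardly overlap, so there are O(n/2^a) codes at each level a.

open import Defs
open import Data.Nat using (ℕ; zero; suc; _+_; _*_; _∸_; _^_; _⊓_; _≤_; _<_; z≤n; s≤s; s≤s⁻¹; _≤?_; _<?_; >-nonZero)
open import Data.Nat.Properties
open import Data.Nat.DivMod using (_/_; _%_; m≡m%n+[m/n]*n; m%n<n; m/n*n≤m; m*n/n≡m; /-monoˡ-≤)
open import Data.Nat.Logarithm using (⌊log₂_⌋; ⌊log₂⌋-mono-≤; ⌊log₂[2^n]⌋≡n)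
open import Data.Nat.Tactic.RingSolver using (solve)
open import Data.List using (List; []; _∷_; _++_; length; map; filter; applyUpTo; upTo; cartesianProduct)
open import Data.List.Properties using (length-map; length-++; length-applyUpTo; filter-++)
open import Data.List.Membership.Propositional using (_∈_)
open import Data.List.Membership.Propositional.Properties using (∈-∃++; ∈-++⁻; ∈-++⁺ˡ; ∈-++⁺ʳ; ∈-map⁺; ∈-filter⁺; ∈-upTo⁺; ∈-cartesianProduct⁺)
open import Data.List.Relation.Unary.Any using (here; there)
open import Data.List.Relation.Unary.All using (All)
import Data.List.Relation.Unary.All as All
open import Data.List.Relation.Unary.All.Properties using (all-filter)
import Data.List.Relation.Unary.AllPairs as AllPairs
open import Data.List.Relation.Unary.Unique.Propositional using (Unique)
import Data.List.Relation.Unary.Unique.Propositional.Properties as Unique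
open import Data.Product using (Σ; ∃; _×_; _,_; proj₁; proj₂)
open import Data.Sum using (_⊎_; inj₁; inj₂)
open import Data.Empty using (⊥-elim)
open import Function using (_∘_; id; case_of_)
open import Relation.Binary.PropositionalEquality
open import Relation.Nullary using (¬_; Dec; yes; no)
open import Relation.Nullary.Decidable using (decidable-stable; ¬¬-excluded-middle; ¬?; _×-dec_; _→-dec_; map′)
open import Relation.Binary.Definitions using (tri<; tri≈; tri>)

-- Linear arithmetic by an explicit certificate: the hypotheses are added up
-- into l ≤ r, and the remaining equation is left to the ring solver.
≤-certificate : ∀ {x y} l r s → l ≤ r → x + r + s ≡ y + l → x ≤ y
≤-certificate {x} {y} l r s l≤r eq =
  +-cancelʳ-≤ l x y (≤-trans (+-monoʳ-≤ x l≤r) (≤-trans (m≤m+n (x + r) s) (≤-reflexive eq)))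

-- Counting

module _ {X Y : Set} where

  -- Pigeonhole along a relation: a code only has to exist, and an element may have several. The
  -- code of the head is deleted from `ys`; by injectivity no element of the tail relates to it.
  Unique⇒length≤ : (_~_ : X → Y → Set) → (∀ {x x′ y} → x ~ y → x′ ~ y → x ≡ x′) →
    (xs : List X) → Unique xs → (ys : List Y) →
    (∀ {x} → x ∈ xs → ∃ λ y → y ∈ ys × x ~ y) → length xs ≤ length ys
  Unique⇒length≤ _~_ inj [] _ ys _ = z≤n
  Unique⇒length≤ _~_ inj (x ∷ xs) (x∉xs AllPairs.∷ uniq) ys code with code (here refl)
  ... | y , y∈ys , x~y with ∈-∃++ y∈ys
  ... | as , bs , refl = begin
    suc (length xs)              ≤⟨ s≤s (Unique⇒length≤ _~_ inj xs uniq (as ++ bs) code′) ⟩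
    suc (length (as ++ bs))      ≡⟨ cong suc (length-++ as) ⟩
    suc (length as + length bs)  ≡⟨ sym (+-suc (length as) (length bs)) ⟩
    length as + suc (length bs)  ≡⟨ sym (length-++ as) ⟩
    length (as ++ y ∷ bs)        ∎
    where
    open ≤-Reasoning
    code′ : ∀ {x′} → x′ ∈ xs → ∃ λ y′ → y′ ∈ as ++ bs × x′ ~ y′
    code′ x′∈ with code (there x′∈)
    ... | y′ , y′∈ , r with ∈-++⁻ as y′∈
    ... | inj₁ l = y′ , ∈-++⁺ˡ l , r
    ... | inj₂ (there l) = y′ , ∈-++⁺ʳ as l , r
    ... | inj₂ (here refl) = ⊥-elim (All.lookup x∉xs x′∈ (inj x~y r))

-- Indicators and finite sums

𝟙 : {P : Set} → Dec P → ℕ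
𝟙 (yes _) = 1
𝟙 (no _)  = 0

𝟙-yes : {P : Set} (d : Dec P) → P → 𝟙 d ≡ 1
𝟙-yes (yes _) _ = refl
𝟙-yes (no ¬p) p = ⊥-elim (¬p p)

𝟙-no : {P : Set} (d : Dec P) → ¬ P → 𝟙 d ≡ 0
𝟙-no (yes p) ¬p = ⊥-elim (¬p p)
𝟙-no (no _)  _ = refl

𝟙-mono : {P Q : Set} (d : Dec P) (e : Dec Q) → (P → Q) → 𝟙 d ≤ 𝟙 e
𝟙-mono (no _)  e f = z≤n
𝟙-mono (yes p) e f = ≤-reflexive (sym (𝟙-yes e (f p)))

∑ : ℕ → (ℕ → ℕ) → ℕ
∑ zero    f = 0
∑ (suc n) f = f 0 + ∑ n (f ∘ suc)

∑-mono : ∀ n {f g : ℕ → ℕ} → (∀ i → i < n → f i ≤ g i) → ∑ n f ≤ ∑ n g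
∑-mono zero    le = z≤n
∑-mono (suc n) le = +-mono-≤ (le 0 (s≤s z≤n)) (∑-mono n (λ i i<n → le (suc i) (s≤s i<n)))

∑-cong : ∀ n {f g : ℕ → ℕ} → (∀ i → f i ≡ g i) → ∑ n f ≡ ∑ n g
∑-cong zero    eq = refl
∑-cong (suc n) eq = cong₂ _+_ (eq 0) (∑-cong n (eq ∘ suc))

∑-zero : ∀ n → ∑ n (λ _ → 0) ≡ 0
∑-zero zero    = refl
∑-zero (suc n) = ∑-zero n

∑-+ : ∀ n (f g : ℕ → ℕ) → ∑ n (λ i → f i + g i) ≡ ∑ n f + ∑ n g
∑-+ zero    f g = refl
∑-+ (suc n) f g rewrite ∑-+ n (f ∘ suc) (g ∘ suc) = interchange (f 0) (g 0) (∑ n (f ∘ suc)) (∑ n (g ∘ suc))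
  where
  interchange : ∀ a b c d → a + b + (c + d) ≡ a + c + (b + d)
  interchange a b c d = solve (a ∷ b ∷ c ∷ d ∷ [])

∑-*ˡ : ∀ n c (f : ℕ → ℕ) → ∑ n (λ i → c * f i) ≡ c * ∑ n f
∑-*ˡ zero    c f = sym (*-zeroʳ c)
∑-*ˡ (suc n) c f = trans (cong (c * f 0 +_) (∑-*ˡ n c (f ∘ suc))) (sym (*-distribˡ-+ c (f 0) (∑ n (f ∘ suc))))

∑-swap : ∀ m n (f : ℕ → ℕ → ℕ) → ∑ m (λ i → ∑ n (f i)) ≡ ∑ n (λ j → ∑ m (λ i → f i j))
∑-swap zero    n f = sym (∑-zero n)
∑-swap (suc m) n f = trans (cong (∑ n (f 0) +_) (∑-swap m n (f ∘ suc))) (sym (∑-+ n (f 0) (λ j → ∑ m (λ i → f (suc i) j))))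

𝟙-*-≤ : {P Q R : Set} (d : Dec P) (e : Dec Q) (f : Dec R) → (P → Q → R) → 𝟙 d * 𝟙 e ≤ 𝟙 f
𝟙-*-≤ (no _)  e       f h = z≤n
𝟙-*-≤ (yes p) (no _)  f h = z≤n
𝟙-*-≤ (yes p) (yes q) f h = ≤-reflexive (sym (𝟙-yes f (h p q)))

-- Sums over a window keep its absolute starting point, so that the left end can be peeled off
-- without shifting the summand.
∑from : ℕ → ℕ → (ℕ → ℕ) → ℕ
∑from s zero    f = 0
∑from s (suc n) f = f s + ∑from (suc s) n f

∑≡∑from : ∀ s n (f : ℕ → ℕ) → ∑ n (λ i → f (s + i)) ≡ ∑from s n f
∑≡∑from s zero    f = refl
∑≡∑from s (suc n) f = cong₂ _+_ (cong f (+-identityʳ s))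
  (trans (∑-cong n (λ i → cong f (+-suc s i))) (∑≡∑from (suc s) n f))

∑from-+ : ∀ s n (f g : ℕ → ℕ) → ∑from s n (λ i → f i + g i) ≡ ∑from s n f + ∑from s n g
∑from-+ s n f g = trans (sym (∑≡∑from s n _)) (trans (∑-+ n (λ i → f (s + i)) (λ i → g (s + i)))
  (cong₂ _+_ (∑≡∑from s n f) (∑≡∑from s n g)))

∑from-⊆ : ∀ {s n m r} {f g : ℕ → ℕ} → s ≤ m → m + r ≤ s + n →
  (∀ x → m ≤ x → x < m + r → f x ≤ g x) → ∑from m r f ≤ ∑from s n g
∑from-⊆ {r = zero} _ _ _ = z≤n
∑from-⊆ {s} {zero} {m} {suc r} s≤m m+r≤s _ = ⊥-elim (<⇒≱ (≤-trans (s≤s s≤m) (m<m+n m (s≤s z≤n))) (≤-trans m+r≤s (≤-reflexive (+-identityʳ s))))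
∑from-⊆ {s} {suc n} {m} {suc r} {f} {g} s≤m m+r≤ le with m≤n⇒m<n∨m≡n s≤m
... | inj₁ s<m = ≤-trans (∑from-⊆ {suc s} {n} {m} {suc r} {f} {g} s<m (≤-trans m+r≤ (≤-reflexive (+-suc s n))) le) (m≤n+m _ (g s))
... | inj₂ refl = +-mono-≤ (le s ≤-refl (m<m+n s (s≤s z≤n)))
    (∑from-⊆ {suc s} {n} {suc s} {r} {f} {g} ≤-refl (≤-trans (≤-reflexive (sym (+-suc s r))) (≤-trans m+r≤ (≤-reflexive (+-suc s n))))
      (λ x s<x x< → le x (<⇒≤ s<x) (≤-trans x< (≤-reflexive (sym (+-suc s r))))))

∑from-truncate : ∀ s n ℓ {f g : ℕ → ℕ} → (∀ x → f x ≤ g x) → (∀ x → s + ℓ ≤ x → f x ≡ 0) → ∑from s n f ≤ ∑from s ℓ g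
∑from-truncate s zero    ℓ       le z = z≤n
∑from-truncate s (suc n) zero {f} {g} le z = +-mono-≤ (≤-reflexive (z s (≤-reflexive (+-identityʳ s))))
  (∑from-truncate (suc s) n zero {f} {g} le (λ x s<x → z x (≤-trans (n≤1+n _) s<x)))
∑from-truncate s (suc n) (suc ℓ) le z = +-mono-≤ (le s)
  (∑from-truncate (suc s) n ℓ le (λ x s+ℓ<x → z x (≤-trans (≤-reflexive (+-suc s ℓ)) s+ℓ<x)))

module _ {P : ℕ × ℕ → Set} (P? : ∀ x → Dec (P x)) where

  length-filter-row : ∀ i (f : ℕ → ℕ) n → length (filter P? (map (i ,_) (applyUpTo f n))) ≡ ∑ n (λ j → 𝟙 (P? (i , f j)))
  length-filter-row i f zero = refl
  length-filter-row i f (suc n) with P? (i , f 0)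
  ... | yes _ = cong suc (length-filter-row i (f ∘ suc) n)
  ... | no  _ = length-filter-row i (f ∘ suc) n

  length-filter-box : ∀ (f : ℕ → ℕ) m n → length (filter P? (cartesianProduct (applyUpTo f m) (upTo n))) ≡ ∑ m (λ i → ∑ n (λ j → 𝟙 (P? (f i , j))))
  length-filter-box f zero n = refl
  length-filter-box f (suc m) n = begin
    length (filter P? (map (f 0 ,_) (upTo n) ++ rest))                     ≡⟨ cong length (filter-++ P? (map (f 0 ,_) (upTo n)) rest) ⟩
    length (filter P? (map (f 0 ,_) (upTo n)) ++ filter P? rest)           ≡⟨ length-++ (filter P? (map (f 0 ,_) (upTo n))) ⟩
    length (filter P? (map (f 0 ,_) (upTo n))) + length (filter P? rest)   ≡⟨ cong₂ _+_ (length-filter-row (f 0) id n) (length-filter-box (f ∘ suc) m n) ⟩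
    ∑ n (λ j → 𝟙 (P? (f 0 , j))) + ∑ m (λ i → ∑ n (λ j → 𝟙 (P? (f (suc i) , j)))) ∎
    where
    open ≡-Reasoning
    rest : List (ℕ × ℕ)
    rest = cartesianProduct (applyUpTo (f ∘ suc) m) (upTo n)

  -- Repeats are bounded as duplicate-free lists, through codes, but charged as sums. This lemma and
  -- the next translate between the two.
  ∑∑-𝟙-≤ : ∀ m n B → (∀ (L : List (ℕ × ℕ)) → Unique L → All P L → length L ≤ B) →
    ∑ m (λ i → ∑ n (λ j → 𝟙 (P? (i , j)))) ≤ B
  ∑∑-𝟙-≤ m n B bound = ≤-trans (≤-reflexive (sym (length-filter-box id m n)))
    (bound _ (Unique.filter⁺ P? (Unique.cartesianProduct⁺ (Unique.upTo⁺ m) (Unique.upTo⁺ n))) (all-filter P? (cartesianProduct (upTo m) (upTo n))))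

  length≤∑∑-𝟙 : ∀ m n (L : List (ℕ × ℕ)) → Unique L → All (λ x → proj₁ x < m × proj₂ x < n × P x) L →
    length L ≤ ∑ m (λ i → ∑ n (λ j → 𝟙 (P? (i , j))))
  length≤∑∑-𝟙 m n L uniq all = ≤-trans
    (Unique⇒length≤ _≡_ (λ { refl refl → refl }) L uniq _
      (λ {x} x∈L → let (a , b , c) = All.lookup all x∈L in
        x , ∈-filter⁺ P? (∈-cartesianProduct⁺ (∈-upTo⁺ a) (∈-upTo⁺ b)) c , refl))
    (≤-reflexive (length-filter-box id m n))

-- The grid of codes

data Tag : Set where
  short aperiodic left right : Tag

tags : List Tag
tags = short ∷ aperiodic ∷ left ∷ right ∷ []

∈-tags : ∀ t → t ∈ tags
∈-tags short     = here refl
∈-tags aperiodic = there (here refl)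
∈-tags left      = there (there (here refl))
∈-tags right     = there (there (there (here refl)))

ground : ℕ × ℕ → ℕ × ℕ × ℕ
ground zc = 0 , zc

raise : ℕ × ℕ × ℕ → ℕ × ℕ × ℕ
raise (a , zc) = suc a , zc

-- On level `a` the middle coordinate numbers multiples of `2 ^ a`, so each level has half the room
-- of the one before. The sizes form a geometric series, which keeps the number of levels out of
-- `length-grid`.
grid : (levels N width : ℕ) → List (ℕ × ℕ × ℕ)
grid zero         N width = []
grid (suc levels) N width =
  map ground (cartesianProduct (upTo N) (upTo width)) ++
  map raise (grid levels (N / 2) width)

length-cartesianProduct : ∀ {X Y : Set} (xs : List X) (ys : List Y) → length (cartesianProduct xs ys) ≡ length xs * length ys
length-cartesianProduct []       ys = refl
length-cartesianProduct (x ∷ xs) ys = trans (length-++ (map (x ,_) ys))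
  (cong₂ _+_ (length-map (x ,_) ys) (length-cartesianProduct xs ys))

length-grid : ∀ levels N width → length (grid levels N width) ≤ 2 * N * width
length-grid zero         N width = z≤n
length-grid (suc levels) N width = begin
  length (map ground row ++ rest)              ≡⟨ length-++ (map ground row) ⟩
  length (map ground row) + length rest        ≡⟨ cong₂ _+_ (length-map ground row) (length-map _ (grid levels (N / 2) width)) ⟩
  length row + length (grid levels (N / 2) width) ≤⟨ +-mono-≤ (≤-reflexive length-row) (length-grid levels (N / 2) width) ⟩
  N * width + 2 * (N / 2) * width              ≤⟨ +-monoʳ-≤ (N * width) (*-monoˡ-≤ width (≤-trans (≤-reflexive (*-comm 2 (N / 2))) (m/n*n≤m N 2))) ⟩
  N * width + N * width                        ≡⟨ solve (N ∷ width ∷ []) ⟩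
  2 * N * width                                ∎
  where
  open ≤-Reasoning
  row : List (ℕ × ℕ)
  row = cartesianProduct (upTo N) (upTo width)
  rest : List (ℕ × ℕ × ℕ)
  rest = map raise (grid levels (N / 2) width)
  length-row : length row ≡ N * width
  length-row = trans (length-cartesianProduct (upTo N) (upTo width)) (cong₂ _*_ (length-applyUpTo id N) (length-applyUpTo id width))

-- On a positive level the left side of the bound by `N` is even, so it survives halving `N` and
-- rounding down.
∈-grid : ∀ {levels N width a z c} → a < levels → suc z * 2 ^ a ≤ N → c < width → (a , z , c) ∈ grid levels N width
∈-grid {suc levels} {N} {width} {zero} {z} _ z< c< =
  ∈-++⁺ˡ (∈-map⁺ ground (∈-cartesianProduct⁺ (∈-upTo⁺ (≤-trans (≤-reflexive (sym (*-identityʳ (suc z)))) z<)) (∈-upTo⁺ c<)))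
∈-grid {suc levels} {N} {width} {suc a} {z} (s≤s a<) z< c< =
  ∈-++⁺ʳ (map ground (cartesianProduct (upTo N) (upTo width))) (∈-map⁺ _ (∈-grid a< z<′ c<))
  where
  z<′ : suc z * 2 ^ a ≤ N / 2
  z<′ = ≤-trans (≤-reflexive (sym (m*n/n≡m (suc z * 2 ^ a) 2)))
    (/-monoˡ-≤ 2 (≤-trans (≤-reflexive (trans (*-assoc (suc z) (2 ^ a) 2) (cong (suc z *_) (*-comm (2 ^ a) 2)))) z<))

-- Dyadic scales and least witnesses

n<2^n : ∀ n → n < 2 ^ n
n<2^n zero    = s≤s z≤n
n<2^n (suc n) = ≤-certificate (suc n + suc n) (2 ^ n + 2 ^ n) n (+-mono-≤ (n<2^n n) (n<2^n n)) (eq n (2 ^ n))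
  where
  eq : ∀ n t → 2 + n + (t + t) + n ≡ t + (t + 0) + (1 + n + (1 + n))
  eq n t = solve (n ∷ t ∷ [])

0<2^ : ∀ n → 0 < 2 ^ n
0<2^ n = ≤-trans (s≤s z≤n) (n<2^n n)

dyadic-scale : ∀ c x → 0 < c → c < x → ∃ λ i → c * 2 ^ i < x × x ≤ c * 2 ^ suc i
-- The exponent `x` is large enough because `x < 2 ^ x`; the search lowers it until the strict bound
-- holds.
dyadic-scale c x 0<c c<x = search x (≤-trans (<⇒≤ (n<2^n x)) (≤-trans (≤-reflexive (sym (*-identityˡ _))) (*-monoˡ-≤ (2 ^ x) 0<c)))
  where
  search : ∀ f → x ≤ c * 2 ^ f → ∃ λ i → c * 2 ^ i < x × x ≤ c * 2 ^ suc i
  search zero    le = ⊥-elim (<⇒≱ c<x (≤-trans le (≤-reflexive (*-identityʳ c))))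
  search (suc f) le with c * 2 ^ f <? x
  ... | yes lt = f , lt , le
  ... | no ≮x  = search f (≮⇒≥ ≮x)

dyadic-floor : ∀ p → 0 < p → ∃ λ a → 2 ^ a ≤ p × p < 2 * 2 ^ a
dyadic-floor p 0<p with dyadic-scale 1 (suc p) (s≤s z≤n) (s≤s 0<p)
... | a , s≤s lo , hi = a , ≤-trans (≤-reflexive (sym (*-identityˡ (2 ^ a)))) lo , ≤-trans hi (≤-reflexive (*-identityˡ _))

least : {P : ℕ → Set} (P? : ∀ d → Dec (P d)) → ∀ h →
  (∀ d → d < h → ¬ P d) ⊎ ∃ λ p → p < h × P p × (∀ d → d < p → ¬ P d)
least P? zero = inj₁ λ d ()
least P? (suc h) with least P? h
... | inj₂ (p , p<h , Pp , min) = inj₂ (p , m<n⇒m<1+n p<h , Pp , min)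
... | inj₁ none with P? h
...   | yes Ph = inj₂ (h , ≤-refl , Ph , none)
...   | no ¬Ph = inj₁ λ d d<1+h → case m≤n⇒m<n∨m≡n (s≤s⁻¹ d<1+h) of λ where
        (inj₁ d<h)  → none d d<h
        (inj₂ refl) → ¬Ph

-- Periodicity

module Strings {A : Set} (T : ℕ → A) where

  -- d is a period of the fragment at positions u + 1, …, v.
  Periodic : (d u v : ℕ) → Set
  Periodic d u v = ∀ x → u < x → x + d ≤ v → T x ≡ T (x + d)

  Arm : (q ℓ g : ℕ) → Set
  Arm q ℓ g = ∀ x → q < x → x ≤ q + g → T x ≡ T (x + ℓ)

  Periodic-shrink : ∀ {d u v v′} → v′ ≤ v → Periodic d u v → Periodic d u v′
  Periodic-shrink v′≤v per x u<x x+d≤v′ = per x u<x (≤-trans x+d≤v′ v′≤v)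

  -- Steps of length `p` move `z` and `z + d` together into the window `(c , c + p]`, where `d` is
  -- known to act as a period. `forward` comes from the right of `c`, `backward` from the left;
  -- their argument `k` bounds the number of steps.
  Periodic-extend : ∀ {p d u v c} → 1 ≤ p → Periodic p u v → u ≤ c → c + p + d ≤ v →
    (∀ z → c < z → z ≤ c + p → T z ≡ T (z + d)) → Periodic d u v
  Periodic-extend {p} {d} {u} {v} {c} 1≤p per u≤c c+p+d≤v local x u<x =
    backward (suc c) x (≤-trans (s≤s (m≤n+m c x)) (≤-reflexive (sym (+-suc x c)))) u<x
    where
    forward : ∀ k y → c < y → y ≤ c + p + k → y + d ≤ v → T y ≡ T (y + d)
    forward k y c<y y≤ y+d≤v with y ≤? c + p
    forward k       y c<y y≤ y+d≤v | yes y≤c+p = local y c<y y≤c+p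
    forward zero    y c<y y≤ y+d≤v | no y≰c+p = ⊥-elim (y≰c+p (≤-trans y≤ (≤-reflexive (+-identityʳ (c + p)))))
    forward (suc k) y c<y y≤ y+d≤v | no y≰c+p =
      subst (λ w → T w ≡ T (w + d)) y′+p≡y (step (y ∸ p)
        (+-cancelʳ-< p c (y ∸ p) (≤-trans (≰⇒> y≰c+p) (≤-reflexive (sym y′+p≡y))))
        (≤-trans (≤-reflexive y′+p≡y) y≤) (≤-trans (≤-reflexive (cong (_+ d) y′+p≡y)) y+d≤v))
      where
      y′+p≡y : y ∸ p + p ≡ y
      y′+p≡y = m∸n+n≡m (≤-trans (m≤n+m p c) (<⇒≤ (≰⇒> y≰c+p)))
      step : ∀ w → c < w → w + p ≤ c + p + suc k → w + p + d ≤ v → T (w + p) ≡ T (w + p + d)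
      step w c<w w+p≤ w+p+d≤v = begin
        T (w + p)      ≡⟨ sym (per w (≤-trans (s≤s u≤c) c<w) (≤-trans (m≤m+n (w + p) d) w+p+d≤v)) ⟩
        T w            ≡⟨ forward k w c<w (≤-certificate (w + p + 1) (c + p + suc k + p) 0 (+-mono-≤ w+p≤ 1≤p) (solve (w ∷ p ∷ c ∷ k ∷ [])))
                            (≤-certificate (w + p + d) v p w+p+d≤v (solve (w ∷ p ∷ d ∷ v ∷ []))) ⟩
        T (w + d)      ≡⟨ per (w + d) (≤-trans (s≤s u≤c) (≤-trans c<w (m≤m+n w d))) (≤-trans (≤-reflexive eq) w+p+d≤v) ⟩
        T (w + d + p)  ≡⟨ cong T eq ⟩
        T (w + p + d)  ∎
        where
        open ≡-Reasoning
        eq : w + d + p ≡ w + p + d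
        eq = solve (w ∷ d ∷ p ∷ [])
    backward : ∀ k y → c < y + k → u < y → y + d ≤ v → T y ≡ T (y + d)
    backward k y c<y+k u<y y+d≤v with c <? y
    backward k       y c<y+k u<y y+d≤v | yes c<y = forward y y c<y (m≤n+m y (c + p)) y+d≤v
    backward zero    y c<y+k u<y y+d≤v | no c≮y = ⊥-elim (c≮y (≤-trans c<y+k (≤-reflexive (+-identityʳ y))))
    backward (suc k) y c<y+k u<y y+d≤v | no c≮y = begin
      T y            ≡⟨ per y u<y (≤-certificate (y + (c + p + d)) (c + v) d (+-mono-≤ (≮⇒≥ c≮y) c+p+d≤v) (solve (y ∷ p ∷ c ∷ v ∷ d ∷ []))) ⟩
      T (y + p)      ≡⟨ backward k (y + p)
                          (≤-certificate (suc c + 1) (y + suc k + p) 0 (+-mono-≤ c<y+k 1≤p) (solve (c ∷ y ∷ k ∷ p ∷ [])))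
                          (≤-trans u<y (m≤m+n y p)) y+p+d≤v ⟩
      T (y + p + d)  ≡⟨ cong T eq ⟩
      T (y + d + p)  ≡⟨ sym (per (y + d) (≤-trans u<y (m≤m+n y d)) (≤-trans (≤-reflexive (sym eq)) y+p+d≤v)) ⟩
      T (y + d)      ∎
      where
      open ≡-Reasoning
      y+p+d≤v : y + p + d ≤ v
      y+p+d≤v = ≤-certificate (y + (c + p + d)) (c + v) 0 (+-mono-≤ (≮⇒≥ c≮y) c+p+d≤v) (solve (y ∷ p ∷ c ∷ v ∷ d ∷ []))
      eq : y + p + d ≡ y + d + p
      eq = solve (y ∷ p ∷ d ∷ [])

  -- The letters at `x` and `x + d` are both equal to the one at `x + d + ℓ`, the first by the
  -- repeat of period `ℓ + d`, the second by that of period `ℓ`. The fragment begins at the later of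
  -- the two starts, here `q′`, and `q` in the primed version.
  arms⇒Periodic : ∀ {q q′ ℓ d g v} → q ≤ q′ → v ≤ q + g → Arm q ℓ g → Arm q′ (ℓ + d) g → Periodic d q′ v
  arms⇒Periodic {q} {q′} {ℓ} {d} {g} {v} q≤q′ v≤ arm arm′ x q′<x x+d≤v = begin
    T x            ≡⟨ arm′ x q′<x (≤-trans (m≤m+n x d) (≤-trans x+d≤v (≤-trans v≤ (+-monoˡ-≤ g q≤q′)))) ⟩
    T (x + (ℓ + d)) ≡⟨ cong T (solve (x ∷ ℓ ∷ d ∷ [])) ⟩
    T (x + d + ℓ)  ≡⟨ sym (arm (x + d) (≤-trans (≤-trans (s≤s q≤q′) q′<x) (m≤m+n x d)) (≤-trans x+d≤v v≤)) ⟩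
    T (x + d)      ∎
    where open ≡-Reasoning

  arms⇒Periodic′ : ∀ {q q′ ℓ d g v} → q′ ≤ q → v ≤ q′ + g → Arm q ℓ g → Arm q′ (ℓ + d) g → Periodic d q v
  arms⇒Periodic′ {q} {q′} {ℓ} {d} {g} {v} q′≤q v≤ arm arm′ x q<x x+d≤v = begin
    T x            ≡⟨ arm′ x (≤-trans (s≤s q′≤q) q<x) (≤-trans (m≤m+n x d) (≤-trans x+d≤v v≤)) ⟩
    T (x + (ℓ + d)) ≡⟨ cong T (solve (x ∷ ℓ ∷ d ∷ [])) ⟩
    T (x + d + ℓ)  ≡⟨ sym (arm (x + d) (≤-trans q<x (m≤m+n x d)) (≤-trans x+d≤v (≤-trans v≤ (+-monoˡ-≤ g q′≤q)))) ⟩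
    T (x + d)      ∎
    where open ≡-Reasoning

  -- Here the right arms start at the same place, since `q + ℓ = q′ + (ℓ + d)`. The letters at `x`
  -- and `x + d` are both copies of the one at `x ∸ ℓ`.
  right-arms⇒Periodic : ∀ {q q′ ℓ d g} → q ≡ q′ + d → Arm q ℓ g → Arm q′ (ℓ + d) g → Periodic d (q + ℓ) (q + ℓ + g)
  right-arms⇒Periodic {q} {q′} {ℓ} {d} {g} refl arm arm′ x q+ℓ<x x+d≤ =
    subst (λ w → T w ≡ T (w + d)) y+q+ℓ≡x (shifted (x ∸ (q + ℓ)) (m<n⇒0<n∸m q+ℓ<x) (≤-trans (≤-reflexive (cong (_+ d) y+q+ℓ≡x)) x+d≤))
    where
    open ≡-Reasoning
    y+q+ℓ≡x : x ∸ (q + ℓ) + (q + ℓ) ≡ x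
    y+q+ℓ≡x = m∸n+n≡m (<⇒≤ q+ℓ<x)
    shifted : ∀ y → 0 < y → y + (q + ℓ) + d ≤ q + ℓ + g → T (y + (q + ℓ)) ≡ T (y + (q + ℓ) + d)
    shifted y 0<y le = begin
      T (y + (q′ + d + ℓ))      ≡⟨ cong T (solve (y ∷ q′ ∷ d ∷ ℓ ∷ [])) ⟩
      T (q′ + d + y + ℓ)        ≡⟨ sym (arm (q′ + d + y) (≤-certificate 1 y 0 0<y (solve (q′ ∷ d ∷ y ∷ [])))
                                     (≤-certificate (y + (q + ℓ) + d) (q + ℓ + g) d le (solve (q′ ∷ d ∷ y ∷ ℓ ∷ g ∷ [])))) ⟩
      T (q′ + d + y)            ≡⟨ arm′ (q′ + d + y) (≤-certificate 1 y d 0<y (solve (q′ ∷ d ∷ y ∷ [])))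
                                     (≤-certificate (y + (q + ℓ) + d) (q + ℓ + g) 0 le (solve (q′ ∷ d ∷ y ∷ ℓ ∷ g ∷ []))) ⟩
      T (q′ + d + y + (ℓ + d))  ≡⟨ cong T (solve (y ∷ q′ ∷ d ∷ ℓ ∷ [])) ⟩
      T (y + (q′ + d + ℓ) + d)  ∎

  -- Position `q` immediately precedes a run with least period `p`, and `break` says that the run
  -- does not extend to `q`. The length is `7 * h` because arms have length `8 * h` and comparing
  -- two arms whose starts differ by less than `h` costs up to `h`.
  record RunStart (h q p : ℕ) : Set where
    field
      break    : T q ≢ T (q + p)
      positive : 1 ≤ p
      small    : p < h
      periodic : Periodic p q (q + 7 * h)
      minimal  : ∀ d → 1 ≤ d → d < p → ¬ Periodic d q (q + 7 * h)

  open RunStart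

  -- Around X both p and p′ are periods, hence so is p′ ∸ p < p; the period p
  -- carries it over to the whole run, against the minimality of p.
  RunStart-period-≮ : ∀ {P X h q p h′ q′ p′} → RunStart h q p → RunStart h′ q′ p′ →
    P ≤ p → p′ < 2 * P → q + 4 * h < X → X ≤ q + 5 * h → q′ + 4 * h′ < X → X ≤ q′ + 5 * h′ → ¬ p < p′
  RunStart-period-≮ {P} {X} {h} {q} {p} {h′} {q′} {p′} R R′ P≤p p′<2P <X X≤ <X′ X≤′ p<p′ =
    minimal R d (m<n⇒0<n∸m p<p′) d<p (Periodic-extend (positive R) (periodic R) q≤c c+p+d≤ local)
    where
    d c : ℕ
    d = p′ ∸ p
    c = X ∸ p
    d+p≡p′ : d + p ≡ p′
    d+p≡p′ = m∸n+n≡m (<⇒≤ p<p′)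
    c+p≡X : c + p ≡ X
    c+p≡X = m∸n+n≡m {X} {p} (≤-certificate (p + suc (q + 4 * h)) (h + X) (q + 3 * h + 1) (+-mono-≤ (<⇒≤ (small R)) <X) (solve (p ∷ h ∷ q ∷ X ∷ [])))
    p′<2h : p′ < 2 * h
    p′<2h = ≤-trans p′<2P (*-monoʳ-≤ 2 (≤-trans P≤p (<⇒≤ (small R))))
    d<p : d < p
    d<p = +-cancelʳ-< p d p (≤-trans (s≤s (≤-reflexive d+p≡p′)) (≤-trans p′<2P (≤-trans (*-monoʳ-≤ 2 P≤p) (≤-reflexive (cong (p +_) (+-identityʳ p))))))
    q≤c : q ≤ c
    q≤c = +-cancelʳ-≤ p q c (≤-trans {q + p} {X}
      (≤-certificate (p + suc (q + 4 * h)) (h + X) (3 * h + 1) (+-mono-≤ (<⇒≤ (small R)) <X) (solve (p ∷ h ∷ q ∷ X ∷ [])))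
      (≤-reflexive (sym c+p≡X)))
    q′≤c : q′ ≤ c
    q′≤c = +-cancelʳ-≤ p q′ c (≤-trans {q′ + p} {X}
      (≤-certificate (p + (suc p′ + suc (q′ + 4 * h′))) (p′ + (h′ + X)) (3 * h′ + 2) (+-mono-≤ (<⇒≤ p<p′) (+-mono-≤ (small R′) <X′))
          (solve (p ∷ p′ ∷ h′ ∷ q′ ∷ X ∷ [])))
      (≤-reflexive (sym c+p≡X)))
    X+e≤ : ∀ e → e < p → X + e ≤ q + 7 * h
    X+e≤ e e<p = ≤-certificate (X + (suc e + suc p)) (q + 5 * h + (p + h)) (2 + h) (+-mono-≤ X≤ (+-mono-≤ e<p (small R))) (solve (X ∷ e ∷ p ∷ q ∷ h ∷ []))
    c+p+d≤ : c + p + d ≤ q + 7 * h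
    c+p+d≤ = ≤-trans (≤-reflexive (cong (_+ d) c+p≡X)) (X+e≤ d d<p)
    local : ∀ z → c < z → z ≤ c + p → T z ≡ T (z + d)
    local z c<z z≤ = begin
      T z            ≡⟨ periodic R′ z (≤-trans (s≤s q′≤c) c<z)
                          (≤-certificate (z + (X + suc p′)) (X + (q′ + 5 * h′ + h′)) (suc h′) (+-mono-≤ z≤X (+-mono-≤ X≤′ (small R′)))
                              (solve (X ∷ z ∷ p′ ∷ q′ ∷ h′ ∷ []))) ⟩
      T (z + p′)     ≡⟨ cong T (trans (cong (z +_) (sym d+p≡p′)) (sym (+-assoc z d p))) ⟩
      T (z + d + p)  ≡⟨ sym (periodic R (z + d) (≤-trans (s≤s q≤c) (≤-trans c<z (m≤m+n z d)))
                          (≤-trans (≤-reflexive (trans (+-assoc z d p) (cong (z +_) d+p≡p′)))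
                            (≤-certificate (z + (X + suc p′)) (X + (q + 5 * h + 2 * h)) 1 (+-mono-≤ z≤X (+-mono-≤ X≤ p′<2h)) (solve (X ∷ z ∷ p′ ∷ q ∷ h ∷ []))))) ⟩
      T (z + d)      ∎
      where
      open ≡-Reasoning
      z≤X : z ≤ X
      z≤X = ≤-trans z≤ (≤-reflexive c+p≡X)

  -- The later start `q′` would lie within the run of `q`, whose period `p` contradicts the break at
  -- `q′`.
  RunStart-≮ : ∀ {X h q p h′ q′} → RunStart h q p → RunStart h′ q′ p →
    X ≤ q + 5 * h → q′ + 4 * h′ < X → ¬ q < q′
  RunStart-≮ {X} {h} {q} {p} {h′} {q′} R R′ X≤ <X′ q<q′ = break R′ (periodic R q′ q<q′
    (≤-certificate (suc p + (X + suc (q′ + 4 * h′))) (h + (q + 5 * h + X)) (2 + h + 4 * h′) (+-mono-≤ (small R) (+-mono-≤ X≤ <X′))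
        (solve (p ∷ X ∷ q ∷ h ∷ q′ ∷ h′ ∷ []))))

  -- This is the sense in which runs of one dyadic level hardly overlap: the reserved point `X`
  -- belongs to a single run, even if the scales `h` and `h′` differ.
  RunStart-unique : ∀ {P X h q p h′ q′ p′} → RunStart h q p → RunStart h′ q′ p′ →
    P ≤ p → p < 2 * P → P ≤ p′ → p′ < 2 * P →
    q + 4 * h < X → X ≤ q + 5 * h → q′ + 4 * h′ < X → X ≤ q′ + 5 * h′ → p ≡ p′ × q ≡ q′
  RunStart-unique {p = p} {p′ = p′} R R′ P≤p p<2P P≤p′ p′<2P <X X≤ <X′ X≤′ with <-cmp p p′
  ... | tri< p<p′ _ _ = ⊥-elim (RunStart-period-≮ R R′ P≤p p′<2P <X X≤ <X′ X≤′ p<p′)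
  ... | tri> _ _ p′<p = ⊥-elim (RunStart-period-≮ R′ R P≤p′ p<2P <X′ X≤′ <X X≤ p′<p)
  ... | tri≈ _ refl _ = refl , ≤-antisym (≮⇒≥ (RunStart-≮ R′ R X≤′ <X)) (≮⇒≥ (RunStart-≮ R R′ X≤ <X′))

-- Counting left-maximal gapped repeats

division : ∀ m h → 0 < h → ∃ λ r → ∃ λ z → m ≡ r + z * h × r < h
division m (suc h) _ = m % suc h , m / suc h , m≡m%n+[m/n]*n m (suc h) , m%n<n m (suc h)

2^-split : ∀ {a i} → 2 ^ a < 2 ^ i → ∃ λ e → 2 ^ i ≡ 2 ^ e * 2 ^ a
2^-split {a} {i} lt with a ≤? i
... | yes a≤i = i ∸ a , trans (cong (2 ^_) (sym (m∸n+n≡m a≤i))) (^-distribˡ-+-* 2 (i ∸ a) a)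
... | no a≰i = ⊥-elim (<⇒≱ lt (^-monoʳ-≤ 2 (<⇒≤ (≰⇒> a≰i))))

remainder-gap : ∀ {x y r s b h} → x ≡ r + b → y ≡ s + b → s < h → y < x + h
remainder-gap {r = r} {s} {b} {h} refl refl s<h = ≤-certificate (suc s) h r s<h (solve (r ∷ s ∷ b ∷ h ∷ []))

module GappedRepeats {A : Set} (T : ℕ → A) (_≟_ : ∀ i j → Dec (T i ≡ T j)) where

  open Strings T
  open RunStart

  Periodic? : ∀ d u v → Dec (Periodic d u v)
  Periodic? d u v = map′
    (λ per x u<x x+d≤v → per (s≤s (≤-trans (m≤m+n x d) x+d≤v)) u<x x+d≤v)
    (λ per {x} _ → per x)
    (allUpTo? (λ x → (u <? x) →-dec ((x + d ≤? v) →-dec (x ≟ (x + d)))) (suc v))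

  -- The arms after `q` have length about `ℓ / α`, expressed without division. The leading bound
  -- `i < ℓ` gives the form that `allUpTo?` decides.
  Long : (α ℓ q : ℕ) → Set
  Long α ℓ q = ∀ {i} → i < ℓ → 1 ≤ i → i * α < ℓ → T (q + i) ≡ T (q + i + ℓ)

  Long? : ∀ α ℓ q → Dec (Long α ℓ q)
  Long? α ℓ q = allUpTo? (λ i → (1 ≤? i) →-dec ((i * α <? ℓ) →-dec ((q + i) ≟ (q + i + ℓ)))) ℓ

  record AperiodicCode (ℓ q i z c : ℕ) : Set where
    field
      r s       : ℕ
      q≡        : q ≡ r + z * 2 ^ i
      r<        : r < 2 ^ i
      ℓ≡        : ℓ ≡ s + c * 2 ^ i
      s<        : s < 2 ^ i
      mismatch  : T q ≢ T (q + ℓ)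
      arm       : Arm q ℓ (8 * 2 ^ i)
      no-period : ∀ d → 1 ≤ d → d < 2 ^ i → ¬ Periodic d q (q + 7 * 2 ^ i)

  module _ {ℓ q ℓ′ q′ i z c} (C : AperiodicCode ℓ q i z c) (C′ : AperiodicCode ℓ′ q′ i z c) where
    private
      module C  = AperiodicCode C
      module C′ = AperiodicCode C′

    -- Equal codes put both `ℓ′ ∸ ℓ` and the distance of `q` and `q′` below `2 ^ i`. The arms then
    -- share enough for `ℓ′ ∸ ℓ` to be a period of the `7 * 2 ^ i` positions after the later start.
    AperiodicCode-ℓ≮ : ¬ ℓ < ℓ′
    AperiodicCode-ℓ≮ ℓ<ℓ′ = case ≤-total q q′ of λ where
        (inj₁ q≤q′) → C′.no-period d 0<d d<h (arms⇒Periodic q≤q′ (7h≤8h (2 ^ i) q′<q+h) C.arm arm′)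
        (inj₂ q′≤q) → C.no-period d 0<d d<h (arms⇒Periodic′ q′≤q (7h≤8h (2 ^ i) q<q′+h) C.arm arm′)
      where
      d : ℕ
      d = ℓ′ ∸ ℓ
      ℓ+d≡ℓ′ : ℓ + d ≡ ℓ′
      ℓ+d≡ℓ′ = m+[n∸m]≡n (<⇒≤ ℓ<ℓ′)
      0<d : 0 < d
      0<d = m<n⇒0<n∸m ℓ<ℓ′
      d<h : d < 2 ^ i
      d<h = +-cancelˡ-< ℓ d (2 ^ i) (≤-trans (s≤s (≤-reflexive ℓ+d≡ℓ′)) (remainder-gap C.ℓ≡ C′.ℓ≡ C′.s<))
      arm′ : Arm q′ (ℓ + d) (8 * 2 ^ i)
      arm′ = subst (λ l → Arm q′ l (8 * 2 ^ i)) (sym ℓ+d≡ℓ′) C′.arm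
      q′<q+h : q′ < q + 2 ^ i
      q′<q+h = remainder-gap C.q≡ C′.q≡ C′.r<
      q<q′+h : q < q′ + 2 ^ i
      q<q′+h = remainder-gap C′.q≡ C.q≡ C.r<
      7h≤8h : ∀ {x y} h → x < y + h → x + 7 * h ≤ y + 8 * h
      7h≤8h {x} {y} h lt = ≤-certificate (suc x) (y + h) 1 lt (solve (x ∷ y ∷ h ∷ []))

    -- With equal periods, the mismatch at `q′` would fall inside the arm of `q`.
    AperiodicCode-q≮ : ℓ ≡ ℓ′ → ¬ q < q′
    AperiodicCode-q≮ refl q<q′ = C′.mismatch (C.arm q′ q<q′ (h≤8h (2 ^ i) (remainder-gap C.q≡ C′.q≡ C′.r<)))
      where
      h≤8h : ∀ h → q′ < q + h → q′ ≤ q + 8 * h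
      h≤8h h lt = ≤-certificate (suc q′) (q + h) (1 + 7 * h) lt (solve (q ∷ q′ ∷ h ∷ []))

  -- The multiples (z + 1) P of P = 2ᵃ at distance in (4h , 5h] from q₀, where
  -- h = 2ⁱ, are reserved for the run starting at q₀.  There are h / P of them,
  -- and the one picked records the digit v of ℓ.
  record RunCode (i q₀ ℓ a z c : ℕ) : Set where
    field
      p r s u v : ℕ
      run       : RunStart (2 ^ i) q₀ p
      P≤p       : 2 ^ a ≤ p
      p<2P      : p < 2 * 2 ^ a
      q₀≡       : q₀ ≡ r + u * 2 ^ a
      r<        : r < 2 ^ a
      ℓ≡        : ℓ ≡ s + (v * 2 ^ a + c * 2 ^ i)
      s<        : s < 2 ^ a
      v<        : suc v * 2 ^ a ≤ 2 ^ i
      z≡        : suc z * 2 ^ a ≡ u * 2 ^ a + 4 * 2 ^ i + suc v * 2 ^ a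

  module _ {i q₀ ℓ a z c} (C : RunCode i q₀ ℓ a z c) where
    open RunCode C

    -- Rounding `q₀` down to a multiple of `2 ^ a` loses less than `2 ^ a`, and the `suc` in `suc v`
    -- makes up for it.
    RunCode-lower : q₀ + 4 * 2 ^ i < suc z * 2 ^ a
    RunCode-lower = ≤-trans (lemma (2 ^ a) (2 ^ i) q₀≡ r<) (≤-reflexive (sym z≡))
      where
      lemma : ∀ P h → q₀ ≡ r + u * P → r < P → q₀ + 4 * h < u * P + 4 * h + suc v * P
      lemma P h q≡ r<P rewrite q≡ = ≤-certificate (suc r) P (v * P) r<P (eq r u v P h)
        where
        eq : ∀ r u v P h → suc (r + u * P + 4 * h) + P + v * P ≡ u * P + 4 * h + suc v * P + suc r
        eq r u v P h = solve (r ∷ u ∷ v ∷ P ∷ h ∷ [])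

    RunCode-upper : suc z * 2 ^ a ≤ q₀ + 5 * 2 ^ i
    RunCode-upper = ≤-trans (≤-reflexive z≡) (lemma (u * 2 ^ a) (2 ^ i) (suc v * 2 ^ a) (≤-trans (m≤n+m _ r) (≤-reflexive (sym q₀≡))) v<)
      where
      lemma : ∀ U h V → U ≤ q₀ → V ≤ h → U + 4 * h + V ≤ q₀ + 5 * h
      lemma U h V U≤ V≤ = ≤-certificate (U + V) (q₀ + h) 0 (+-mono-≤ U≤ V≤) (eq U h V q₀)
        where
        eq : ∀ U h V q → U + 4 * h + V + (q + h) + 0 ≡ q + 5 * h + (U + V)
        eq U h V q = solve (U ∷ h ∷ V ∷ q ∷ [])

  -- For distinct powers of two the intervals `(q + 4h , q + 5h]` are disjoint, since
  -- `5h < 8h ≤ 4h′` when `2h ≤ h′`. Thus the reserved point also reveals the scale `i`.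
  dyadic-≮ : ∀ {q X i i′} → q + 4 * 2 ^ i′ < X → X ≤ q + 5 * 2 ^ i → ¬ i < i′
  dyadic-≮ {q} {X} {i} {i′} <X X≤ i<i′ = <-irrefl refl (lemma (2 ^ i) (2 ^ i′) <X X≤ (^-monoʳ-≤ 2 i<i′))
    where
    lemma : ∀ h h′ → q + 4 * h′ < X → X ≤ q + 5 * h → 2 * h ≤ h′ → X < X
    lemma h h′ a b c = ≤-certificate (suc (q + 4 * h′) + (X + 4 * (2 * h))) (X + (q + 5 * h + 4 * h′)) (3 * h)
      (+-mono-≤ a (+-mono-≤ b (*-monoʳ-≤ 4 c))) (solve (q ∷ X ∷ h ∷ h′ ∷ []))

  -- The reserved point determines the run and the scale, and then `u` and the digit `v`. So `ℓ` and
  -- `ℓ′` differ only in remainders modulo `2 ^ a`, by less than the least period `p`.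
  RunCode-unique : ∀ {i q₀ ℓ i′ q₀′ ℓ′ a z c} → RunCode i q₀ ℓ a z c → RunCode i′ q₀′ ℓ′ a z c →
    q₀ ≡ q₀′ × i ≡ i′ × (ℓ < ℓ′ → ¬ Periodic (ℓ′ ∸ ℓ) q₀ (q₀ + 7 * 2 ^ i))
  RunCode-unique {i} {q₀} {ℓ} {i′} {q₀′} {ℓ′} {a} {z} {c} C C′
    with RunStart-unique C.run C′.run C.P≤p C.p<2P C′.P≤p C′.p<2P
           (RunCode-lower C) (RunCode-upper C) (RunCode-lower C′) (RunCode-upper C′)
    where
    module C  = RunCode C
    module C′ = RunCode C′
  ... | p≡p′ , refl
    with ≤-antisym {i} {i′} (≮⇒≥ (dyadic-≮ {q₀} {i = i′} {i} (RunCode-lower C) (RunCode-upper C′)))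
                          (≮⇒≥ (dyadic-≮ {q₀} {i = i} {i′} (RunCode-lower C′) (RunCode-upper C)))
  ... | refl = refl , refl , λ ℓ<ℓ′ → minimal C.run (ℓ′ ∸ ℓ) (m<n⇒0<n∸m ℓ<ℓ′)
      (+-cancelˡ-< ℓ (ℓ′ ∸ ℓ) C.p (≤-trans (s≤s (≤-reflexive (m+[n∸m]≡n (<⇒≤ ℓ<ℓ′))))
        (≤-trans (remainder-gap {r = C.s} C.ℓ≡ ℓ′≡ C′.s<) (+-monoʳ-≤ ℓ C.P≤p))))
    where
    module C  = RunCode C
    module C′ = RunCode C′
    P h : ℕ
    P = 2 ^ a
    h = 2 ^ i
    u≡u′ : C.u ≡ C′.u
    u≡u′ = ≤-antisym (u≤ C.q₀≡ C′.q₀≡ C′.r<) (u≤ C′.q₀≡ C.q₀≡ C.r<)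
      where
      u≤ : ∀ {r u r′ u′} → q₀ ≡ r + u * P → q₀ ≡ r′ + u′ * P → r′ < P → u ≤ u′
      u≤ {r} {u} {r′} {u′} eq eq′ r′<P = s≤s⁻¹ (*-cancelʳ-< P u (suc u′) (≤-trans (s≤s (≤-trans (m≤n+m (u * P) r) (≤-reflexive (trans (sym eq) eq′)))) (+-monoˡ-≤ (u′ * P) r′<P)))
    v≡v′ : C.v * P ≡ C′.v * P
    v≡v′ = +-cancelˡ-≡ (C.u * P + 4 * h + P) _ _
      (trans (+-assoc (C.u * P + 4 * h) P (C.v * P)) (trans (sym C.z≡) (trans C′.z≡
        (trans (cong (λ w → w * P + 4 * h + suc C′.v * P) (sym u≡u′)) (sym (+-assoc (C.u * P + 4 * h) P (C′.v * P)))))))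
    ℓ′≡ : ℓ′ ≡ C′.s + (C.v * P + c * h)
    ℓ′≡ = trans C′.ℓ≡ (cong (λ w → C′.s + (w + c * h)) (sym v≡v′))

  -- A repeat whose arm has a small period p starts where a p-periodic run
  -- starts, in its left or in its right arm: otherwise it could be extended.
  data Code : ℕ × ℕ → Tag × ℕ × ℕ × ℕ → Set where
    short     : ∀ {ℓ q} → Code (ℓ , q) (short , 0 , q , ℓ)
    aperiodic : ∀ {ℓ q i z c} → AperiodicCode ℓ q i z c → Code (ℓ , q) (aperiodic , i , z , c)
    left      : ∀ {ℓ q i a z c} → RunCode i q ℓ a z c → Arm q ℓ (8 * 2 ^ i) → Code (ℓ , q) (left , a , z , c)
    right     : ∀ {ℓ q i a z c} → RunCode i (q + ℓ) ℓ a z c → Arm q ℓ (8 * 2 ^ i) → Code (ℓ , q) (right , a , z , c)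

  7h≤8h : ∀ q h → q + 7 * h ≤ q + 8 * h
  7h≤8h q h = ≤-certificate 0 h 0 z≤n (solve (q ∷ h ∷ []))

  -- The two repeats share the run at which their left arms start, so `ℓ′ ∸ ℓ` would be one of its
  -- periods. `right-≮` does the same with the right arms.
  left-≮ : ∀ {ℓ q ℓ′ q′ i i′ a z c} → RunCode i q ℓ a z c → Arm q ℓ (8 * 2 ^ i) →
    RunCode i′ q′ ℓ′ a z c → Arm q′ ℓ′ (8 * 2 ^ i′) → ¬ ℓ < ℓ′
  left-≮ {ℓ} {q} {ℓ′} {i = i} C arm C′ arm′ ℓ<ℓ′ with RunCode-unique C C′
  ... | refl , refl , clash = clash ℓ<ℓ′ (arms⇒Periodic ≤-refl (7h≤8h q (2 ^ i)) arm
    (subst (λ l → Arm q l (8 * 2 ^ i)) (sym (m+[n∸m]≡n (<⇒≤ ℓ<ℓ′))) arm′))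

  right-≮ : ∀ {ℓ q ℓ′ q′ i i′ a z c} → RunCode i (q + ℓ) ℓ a z c → Arm q ℓ (8 * 2 ^ i) →
    RunCode i′ (q′ + ℓ′) ℓ′ a z c → Arm q′ ℓ′ (8 * 2 ^ i′) → ¬ ℓ < ℓ′
  right-≮ {ℓ} {q} {ℓ′} {q′} {i = i} C arm C′ arm′ ℓ<ℓ′ with RunCode-unique C C′
  ... | q+ℓ≡q′+ℓ′ , refl , clash = clash ℓ<ℓ′ (Periodic-shrink (7h≤8h (q + ℓ) (2 ^ i)) (right-arms⇒Periodic q≡q′+d arm
    (subst (λ l → Arm q′ l (8 * 2 ^ i)) (sym ℓ+d≡ℓ′) arm′)))
    where
    ℓ+d≡ℓ′ : ℓ + (ℓ′ ∸ ℓ) ≡ ℓ′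
    ℓ+d≡ℓ′ = m+[n∸m]≡n (<⇒≤ ℓ<ℓ′)
    q≡q′+d : q ≡ q′ + (ℓ′ ∸ ℓ)
    q≡q′+d = +-cancelʳ-≡ ℓ _ _ (trans q+ℓ≡q′+ℓ′ (trans (cong (q′ +_) (trans (sym ℓ+d≡ℓ′) (+-comm ℓ (ℓ′ ∸ ℓ)))) (sym (+-assoc q′ (ℓ′ ∸ ℓ) ℓ))))

  Code-injective : ∀ {x x′ y} → Code x y → Code x′ y → x ≡ x′
  Code-injective short short = refl
  Code-injective (aperiodic C) (aperiodic C′) =
    let ℓ≡ℓ′ = ≤-antisym (≮⇒≥ (AperiodicCode-ℓ≮ C′ C)) (≮⇒≥ (AperiodicCode-ℓ≮ C C′)) in
    cong₂ _,_ ℓ≡ℓ′ (≤-antisym (≮⇒≥ (AperiodicCode-q≮ C′ C (sym ℓ≡ℓ′))) (≮⇒≥ (AperiodicCode-q≮ C C′ ℓ≡ℓ′)))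
  Code-injective (left C arm) (left C′ arm′) =
    cong₂ _,_ (≤-antisym (≮⇒≥ (left-≮ C′ arm′ C arm)) (≮⇒≥ (left-≮ C arm C′ arm′))) (proj₁ (RunCode-unique C C′))
  Code-injective (right {ℓ} {q} C arm) (right {ℓ′} {q′} C′ arm′)
    with ≤-antisym (≮⇒≥ (right-≮ C′ arm′ C arm)) (≮⇒≥ (right-≮ C arm C′ arm′))
  ... | refl = cong (ℓ ,_) (+-cancelʳ-≡ ℓ q q′ (proj₁ (RunCode-unique C C′)))

  Periodic-transfer : ∀ {d q ℓ g v} → Arm q ℓ g → v ≤ g → Periodic d q (q + v) → Periodic d (q + ℓ) (q + ℓ + v)
  Periodic-transfer {d} {q} {ℓ} {g} {v} arm v≤g per x q+ℓ<x x+d≤ =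
    subst (λ w → T w ≡ T (w + d)) y+ℓ≡x (shifted (x ∸ ℓ)
      (+-cancelʳ-< ℓ q (x ∸ ℓ) (≤-trans q+ℓ<x (≤-reflexive (sym y+ℓ≡x))))
      (≤-trans (≤-reflexive (cong (_+ d) y+ℓ≡x)) x+d≤))
    where
    y+ℓ≡x : x ∸ ℓ + ℓ ≡ x
    y+ℓ≡x = m∸n+n≡m (≤-trans (m≤n+m ℓ q) (<⇒≤ q+ℓ<x))
    shifted : ∀ y → q < y → y + ℓ + d ≤ q + ℓ + v → T (y + ℓ) ≡ T (y + ℓ + d)
    shifted y q<y le = begin
      T (y + ℓ)      ≡⟨ sym (arm y q<y (≤-trans (m≤m+n y d) (≤-trans y+d≤ (+-monoʳ-≤ q v≤g)))) ⟩
      T y            ≡⟨ per y q<y y+d≤ ⟩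
      T (y + d)      ≡⟨ arm (y + d) (≤-trans q<y (m≤m+n y d)) (≤-trans y+d≤ (+-monoʳ-≤ q v≤g)) ⟩
      T (y + d + ℓ)  ≡⟨ cong T (solve (y ∷ d ∷ ℓ ∷ [])) ⟩
      T (y + ℓ + d)  ∎
      where
      open ≡-Reasoning
      y+d≤ : y + d ≤ q + v
      y+d≤ = ≤-certificate (y + ℓ + d) (q + ℓ + v) 0 le (solve (y ∷ d ∷ ℓ ∷ q ∷ v ∷ []))

  Periodic-transfer⁻ : ∀ {d q ℓ g v} → Arm q ℓ g → v ≤ g → Periodic d (q + ℓ) (q + ℓ + v) → Periodic d q (q + v)
  Periodic-transfer⁻ {d} {q} {ℓ} {g} {v} arm v≤g per y q<y y+d≤ = begin
    T y            ≡⟨ arm y q<y (≤-trans (m≤m+n y d) (≤-trans y+d≤ (+-monoʳ-≤ q v≤g))) ⟩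
    T (y + ℓ)      ≡⟨ per (y + ℓ) (+-monoˡ-< ℓ q<y) (≤-certificate (y + d) (q + v) 0 y+d≤ (solve (y ∷ d ∷ ℓ ∷ q ∷ v ∷ []))) ⟩
    T (y + ℓ + d)  ≡⟨ cong T (solve (y ∷ d ∷ ℓ ∷ [])) ⟩
    T (y + d + ℓ)  ≡⟨ sym (arm (y + d) (≤-trans q<y (m≤m+n y d)) (≤-trans y+d≤ (+-monoʳ-≤ q v≤g))) ⟩
    T (y + d)      ∎
    where open ≡-Reasoning

  -- For `α = 2 ^ j` these are the elements of R_j. The mismatch at `q` is the left-maximality, and
  -- the left arm starts right after it.
  Repeat : (α n : ℕ) → ℕ × ℕ → Set
  Repeat α n (ℓ , q) = 1 ≤ ℓ × q + ℓ ≤ n × T q ≢ T (q + ℓ) × Long α ℓ q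

  Repeat? : ∀ α n x → Dec (Repeat α n x)
  Repeat? α n (ℓ , q) = (1 ≤? ℓ) ×-dec (q + ℓ ≤? n) ×-dec ¬? (q ≟ (q + ℓ)) ×-dec Long? α ℓ q

  record Coded (α n : ℕ) (x : ℕ × ℕ) : Set where
    constructor coded
    field
      t      : Tag
      a z c  : ℕ
      z≤     : suc z * 2 ^ a ≤ 2 * n
      c≤     : c ≤ 16 * α
      code   : Code x (t , a , z , c)

  -- Positions run up to `2 * n` because a reserved point may lie up to `5h` beyond its run start,
  -- where `8h ≤ n`. The last coordinate is at most `16 * α` because it is either `ℓ ≤ 8 * α` or the
  -- quotient of some `ℓ ≤ 16αh` by `h`.
  codes : (α n : ℕ) → List (Tag × ℕ × ℕ × ℕ)
  codes α n = cartesianProduct tags (grid (2 * n) (2 * n) (suc (16 * α)))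

  module _ {α n ℓ q} (1≤α : 1 ≤ α) (1≤ℓ : 1 ≤ ℓ) (q+ℓ≤n : q + ℓ ≤ n) (mis : T q ≢ T (q + ℓ)) (long : Long α ℓ q) where

    -- The scale `h = 2 ^ i` is chosen such that arms of length about `ℓ / α` reach at least `8 * h`
    -- positions, while `ℓ / h` stays below a multiple of `α`.
    module _ (i : ℕ) (<ℓ : 8 * α * 2 ^ i < ℓ) (ℓ≤ : ℓ ≤ 8 * α * 2 ^ suc i) where

      private
        h : ℕ
        h = 2 ^ i

      long⇒Arm : Arm q ℓ (8 * h)
      long⇒Arm x q<x x≤ = subst (λ w → T w ≡ T (w + ℓ)) q+y≡x
        (long (≤-trans (s≤s (≤-trans (≤-reflexive (sym (*-identityʳ y))) (*-monoʳ-≤ y 1≤α))) yα<ℓ) (m<n⇒0<n∸m q<x) yα<ℓ)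
        where
        y : ℕ
        y = x ∸ q
        q+y≡x : q + y ≡ x
        q+y≡x = m+[n∸m]≡n (<⇒≤ q<x)
        y≤8h : y ≤ 8 * h
        y≤8h = +-cancelˡ-≤ q y (8 * h) (≤-trans (≤-reflexive q+y≡x) x≤)
        eq : ∀ h α → 8 * h * α ≡ 8 * α * h
        eq h α = solve (h ∷ α ∷ [])
        yα<ℓ : y * α < ℓ
        yα<ℓ = ≤-trans (s≤s (≤-trans (*-monoˡ-≤ α y≤8h) (≤-reflexive (eq h α)))) <ℓ

      8h≤n : 8 * h ≤ n
      8h≤n = ≤-trans (≤-trans (*-monoˡ-≤ h (*-monoʳ-≤ 8 1≤α)) (<⇒≤ <ℓ)) (≤-trans (m≤n+m ℓ q) q+ℓ≤n)

      quotient≤ : ∀ {s c} → ℓ ≡ s + c * h → c ≤ 16 * α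
      quotient≤ {s} {c} ℓ≡ = *-cancelʳ-≤ c (16 * α) h {{m^n≢0 2 i}}
        (≤-trans (m≤n+m (c * h) s) (≤-trans (≤-reflexive (sym ℓ≡)) (≤-trans ℓ≤ (≤-reflexive (eq h α)))))
        where
        eq : ∀ h α → 8 * α * (2 * h) ≡ 16 * α * h
        eq h α = solve (h ∷ α ∷ [])

      code-aperiodic : (∀ d → 1 ≤ d → d < h → ¬ Periodic d q (q + 7 * h)) → Coded α n (ℓ , q)
      code-aperiodic none with division q h (0<2^ i) | division ℓ h (0<2^ i)
      ... | r , z , q≡ , r< | s , c , ℓ≡ , s< = coded aperiodic i z c z≤ (quotient≤ ℓ≡) (aperiodic record
        { r = r ; s = s ; q≡ = q≡ ; r< = r< ; ℓ≡ = ℓ≡ ; s< = s< ; mismatch = mis ; arm = long⇒Arm ; no-period = none })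
        where
        lemma : ∀ {z h q ℓ n} → z * h ≤ q → 8 * h ≤ n → q + ℓ ≤ n → suc z * h ≤ 2 * n
        lemma {z} {h} {q} {ℓ} {n} a b c = ≤-certificate (z * h + (8 * h + (q + ℓ))) (q + (n + n)) (7 * h + ℓ) (+-mono-≤ a (+-mono-≤ b c))
            (solve (z ∷ h ∷ q ∷ ℓ ∷ n ∷ []))
        z≤ : suc z * h ≤ 2 * n
        z≤ = lemma {z} {h} (≤-trans (m≤n+m (z * h) r) (≤-reflexive (sym q≡))) 8h≤n q+ℓ≤n

      -- Write `ℓ = s + v P + c h` with `P = 2 ^ a`. As `v < h / P = 2 ^ e`, the digit `v` can
      -- select one of the `h / P` points reserved for the run.
      run-code : ∀ {q₀ p} → q₀ ≤ n → RunStart h q₀ p →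
        ∃ λ a → ∃ λ z → ∃ λ c → suc z * 2 ^ a ≤ 2 * n × c ≤ 16 * α × RunCode i q₀ ℓ a z c
      run-code {q₀} {p} q₀≤n run with dyadic-floor p (positive run)
      ... | a , P≤p , p<2P with 2^-split {a} {i} (≤-trans (s≤s P≤p) (small run)) | division q₀ (2 ^ a) (0<2^ a) | division ℓ h (0<2^ i)
      ... | e , h≡ | r , u , q₀≡ , r< | t , c , ℓ≡ , t< with division t (2 ^ a) (0<2^ a)
      ... | s , v , t≡ , s< = a , u + 4 * 2 ^ e + v , c ,
          ≤-trans (RunCode-upper rc) (lemma {h} q₀≤n 8h≤n) , quotient≤ ℓ≡ , rc
        where
        v<2^e : v < 2 ^ e
        v<2^e = *-cancelʳ-< (2 ^ a) v (2 ^ e)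
          (≤-trans (s≤s (≤-trans (m≤n+m (v * 2 ^ a) s) (≤-reflexive (sym t≡)))) (≤-trans t< (≤-reflexive h≡)))
        eq : ∀ u e v P → suc (u + 4 * e + v) * P ≡ u * P + 4 * (e * P) + suc v * P
        eq u e v P = solve (u ∷ e ∷ v ∷ P ∷ [])
        lemma : ∀ {h q n} → q ≤ n → 8 * h ≤ n → q + 5 * h ≤ 2 * n
        lemma {h} {q} {n} a b = ≤-certificate (q + 8 * h) (n + n) (3 * h) (+-mono-≤ a b) (solve (h ∷ q ∷ n ∷ []))
        rc : RunCode i q₀ ℓ a (u + 4 * 2 ^ e + v) c
        rc = record
          { p = p ; r = r ; s = s ; u = u ; v = v ; run = run ; P≤p = P≤p ; p<2P = p<2P ; q₀≡ = q₀≡ ; r< = r<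
          ; ℓ≡ = trans ℓ≡ (trans (cong (_+ c * h) t≡) (+-assoc s (v * 2 ^ a) (c * h))) ; s< = s<
          ; v< = ≤-trans (*-monoˡ-≤ (2 ^ a) v<2^e) (≤-reflexive (sym h≡))
          ; z≡ = trans (eq u (2 ^ e) v (2 ^ a)) (cong (λ w → u * 2 ^ a + 4 * w + suc v * 2 ^ a) (sym h≡)) }

      code-left : ∀ {p} → RunStart h q p → Coded α n (ℓ , q)
      code-left run = case run-code (≤-trans (m≤m+n q ℓ) q+ℓ≤n) run of λ where
        (a , z , c , z≤ , c≤ , rc) → coded left a z c z≤ c≤ (left {i = i} rc long⇒Arm)

      code-right : ∀ {p} → RunStart h (q + ℓ) p → Coded α n (ℓ , q)
      code-right run = case run-code q+ℓ≤n run of λ where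
        (a , z , c , z≤ , c≤ , rc) → coded right a z c z≤ c≤ (right {i = i} rc long⇒Arm)

      RunStart-transfer : ∀ {p} → 1 ≤ p → p < h → Periodic p q (q + 7 * h) →
        (∀ d → 1 ≤ d → d < p → ¬ Periodic d q (q + 7 * h)) → T q ≡ T (q + p) → RunStart h (q + ℓ) p
      RunStart-transfer {p} 1≤p p<h per min Tq≡ = record
        { break = break′ ; positive = 1≤p ; small = p<h
        ; periodic = Periodic-transfer {p} {q} {ℓ} {8 * h} {7 * h} long⇒Arm (7h≤8h 0 h) per
        ; minimal = λ d 1≤d d<p per′ → min d 1≤d d<p (Periodic-transfer⁻ {d} {q} {ℓ} {8 * h} {7 * h} long⇒Arm (7h≤8h 0 h) per′) }
        where
        open ≡-Reasoning
        -- If the period extended to the left in both arms, the arms themselves would match at `q`.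
        break′ : T (q + ℓ) ≢ T (q + ℓ + p)
        break′ eq = mis (begin
          T q            ≡⟨ Tq≡ ⟩
          T (q + p)      ≡⟨ long⇒Arm (q + p) (m<m+n q 1≤p) (+-monoʳ-≤ q (≤-trans (<⇒≤ p<h) (m≤m+n h (7 * h)))) ⟩
          T (q + p + ℓ)  ≡⟨ cong T (trans (+-assoc q p ℓ) (trans (cong (q +_) (+-comm p ℓ)) (sym (+-assoc q ℓ p)))) ⟩
          T (q + ℓ + p)  ≡⟨ sym eq ⟩
          T (q + ℓ)      ∎)

      code-periodic : ∀ {p} → 1 ≤ p → p < h → Periodic p q (q + 7 * h) →
        (∀ d → 1 ≤ d → d < p → ¬ Periodic d q (q + 7 * h)) → Coded α n (ℓ , q)
      code-periodic {p} 1≤p p<h per min = case q ≟ (q + p) of λ where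
        (no Tq≢)  → code-left record { break = Tq≢ ; positive = 1≤p ; small = p<h ; periodic = per ; minimal = min }
        (yes Tq≡) → code-right (RunStart-transfer 1≤p p<h per min Tq≡)

    repeat-coded : Coded α n (ℓ , q)
    repeat-coded with ℓ ≤? 8 * α
    -- Such a period is too small for any scale, but there are few enough of them to use the pair as
    -- its own code.
    ... | yes ℓ≤8α = coded short 0 q ℓ (lemma 1≤ℓ q+ℓ≤n) (≤-trans ℓ≤8α (*-monoˡ-≤ α (m≤m+n 8 8))) short
      where
      lemma : ∀ {ℓ q n} → 1 ≤ ℓ → q + ℓ ≤ n → suc q * 1 ≤ 2 * n
      lemma {ℓ} {q} {n} a b = ≤-certificate (1 + (q + ℓ)) (ℓ + n) n (+-mono-≤ a b) (solve (ℓ ∷ q ∷ n ∷ []))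
    ... | no ℓ≰8α with dyadic-scale (8 * α) ℓ (≤-trans 1≤α (m≤m+n α (7 * α))) (≰⇒> ℓ≰8α)
    ...   | i , <ℓ , ℓ≤ with least (λ d → (1 ≤? d) ×-dec Periodic? d q (q + 7 * 2 ^ i)) (2 ^ i)
    ...     | inj₁ none = code-aperiodic i <ℓ ℓ≤ (λ d 1≤d d<h per → none d d<h (1≤d , per))
    ...     | inj₂ (p , p<h , (1≤p , per) , min) =
              code-periodic i <ℓ ℓ≤ 1≤p p<h per (λ d 1≤d d<p per′ → min d d<p (1≤d , per′))

  Coded⇒∈codes : ∀ {α n x} → Coded α n x → ∃ λ y → y ∈ codes α n × Code x y
  Coded⇒∈codes {n = n} (coded t a z c z≤ c≤ code) = _ , ∈-cartesianProduct⁺ (∈-tags t) (∈-grid a< z≤ (s≤s c≤)) , code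
    where
    a< : a < 2 * n
    a< = ≤-trans (n<2^n a) (≤-trans (m≤m+n (2 ^ a) (z * 2 ^ a)) z≤)

  length-repeats : ∀ α n → 1 ≤ α → (L : List (ℕ × ℕ)) → Unique L → All (Repeat α n) L → length L ≤ 272 * (α * n)
  length-repeats α n 1≤α L uniq all = begin
    length L                                              ≤⟨ Unique⇒length≤ Code Code-injective L uniq (codes α n)
                                                               (λ x∈L → let (a , b , c , d) = All.lookup all x∈L in Coded⇒∈codes (repeat-coded 1≤α a b c d)) ⟩
    length (codes α n)                                    ≡⟨ length-cartesianProduct tags (grid (2 * n) (2 * n) (suc (16 * α))) ⟩
    4 * length (grid (2 * n) (2 * n) (suc (16 * α)))      ≤⟨ *-monoʳ-≤ 4 (length-grid (2 * n) (2 * n) (suc (16 * α))) ⟩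
    -- The constant is 272 = 4 · 4 · 17: four tags, at most `4 * n` positions over all levels, and
    -- at most `17 * α` values of the last coordinate.
    4 * (2 * (2 * n) * suc (16 * α))                      ≤⟨ *-monoʳ-≤ 4 (*-monoʳ-≤ (2 * (2 * n)) (+-monoˡ-≤ (16 * α) 1≤α)) ⟩
    4 * (2 * (2 * n) * (α + 16 * α))                      ≡⟨ solve (α ∷ n ∷ []) ⟩
    272 * (α * n)                                         ∎
    where open ≤-Reasoning

  -- Charging mismatches to gapped repeats

  mis : ℕ → ℕ → ℕ
  mis ℓ x = 𝟙 (¬? (x ≟ (x + ℓ)))

  -- ∑_{j ≤ J} 2^(J ∸ j) [Long (2 ^ j) ℓ q]
  weight : (J ℓ q : ℕ) → ℕ
  weight zero    ℓ q = 𝟙 (Long? 1 ℓ q)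
  weight (suc J) ℓ q = 2 * weight J ℓ q + 𝟙 (Long? (2 ^ suc J) ℓ q)

  -- Induction on `J`. If `ℓ ≤ t * 2 ^ suc J`, the new scale counts and `suc (2 * w + 1)` is twice
  -- `suc w`. Otherwise the left side is below `ℓ`, and the `suc` alone suffices.
  weight-lower : ∀ J {ℓ q t} → t ≤ ℓ → (∀ i → 1 ≤ i → i < t → T (q + i) ≡ T (q + i + ℓ)) →
    2 ^ J * t ≤ ℓ * suc (weight J ℓ q)
  weight-lower zero {ℓ} {q} {t} t≤ℓ match = ≤-trans (≤-reflexive (*-identityˡ t)) (≤-trans t≤ℓ (m≤m*n ℓ _))
  weight-lower (suc J) {ℓ} {q} {t} t≤ℓ match with ℓ ≤? t * 2 ^ suc J
  ... | no ℓ≰ = ≤-trans (≤-trans (≤-reflexive (*-comm (2 ^ suc J) t)) (<⇒≤ (≰⇒> ℓ≰))) (m≤m*n ℓ _)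
  ... | yes ℓ≤ = begin
    2 ^ suc J * t                        ≡⟨ *-assoc 2 (2 ^ J) t ⟩
    2 * (2 ^ J * t)                      ≤⟨ *-monoʳ-≤ 2 (weight-lower J t≤ℓ match) ⟩
    2 * (ℓ * suc (weight J ℓ q))         ≡⟨ eq ℓ (weight J ℓ q) ⟩
    ℓ * suc (2 * weight J ℓ q + 1)       ≡⟨ cong (λ w → ℓ * suc (2 * weight J ℓ q + w)) (sym (𝟙-yes (Long? (2 ^ suc J) ℓ q) long)) ⟩
    ℓ * suc (weight (suc J) ℓ q)         ∎
    where
    open ≤-Reasoning
    eq : ∀ ℓ w → 2 * (ℓ * suc w) ≡ ℓ * suc (2 * w + 1)
    eq ℓ w = solve (ℓ ∷ w ∷ [])
    long : Long (2 ^ suc J) ℓ q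
    long {i} _ 1≤i iα<ℓ = match i 1≤i (*-cancelʳ-< (2 ^ suc J) i t (≤-trans iα<ℓ ℓ≤))

  module _ (J ℓ : ℕ) where

    private
      f : ℕ → ℕ
      f x = mis ℓ x * suc (weight J ℓ x)

    -- The window is scanned from its right end. `t` is the number of matches before the first
    -- mismatch, not yet assigned to a gap, and `s` is the length already cut into gaps. A mismatch
    -- at `q` closes a gap of length `suc t`.
    weights-lower : ∀ r q → r ≤ ℓ → ∃ λ t → ∃ λ s →
      t + s ≡ r × (∀ i → i < t → T (q + i) ≡ T (q + i + ℓ)) × 2 ^ J * s ≤ ℓ * ∑from q r f
    weights-lower zero q r≤ℓ = 0 , 0 , refl , (λ i ()) , ≤-trans (≤-reflexive (*-zeroʳ (2 ^ J))) z≤n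
    weights-lower (suc r) q r<ℓ with q ≟ (q + ℓ) | weights-lower r (suc q) (<⇒≤ r<ℓ)
    ... | yes Tq≡ | t , s , t+s≡r , match , le = suc t , s , cong suc t+s≡r , match′ , le
      where
      match′ : ∀ i → i < suc t → T (q + i) ≡ T (q + i + ℓ)
      match′ zero    _         = subst (λ w → T w ≡ T (w + ℓ)) (sym (+-identityʳ q)) Tq≡
      match′ (suc i) (s≤s i<t) = subst (λ w → T w ≡ T (w + ℓ)) (sym (+-suc q i)) (match i i<t)
    ... | no _    | t , s , t+s≡r , match , le = 0 , suc r , refl , (λ i ()) , (begin
      2 ^ J * suc r                                                       ≡⟨ cong (λ w → 2 ^ J * suc w) (sym t+s≡r) ⟩
      2 ^ J * (suc t + s)                                                 ≡⟨ *-distribˡ-+ (2 ^ J) (suc t) s ⟩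
      2 ^ J * suc t + 2 ^ J * s
          ≤⟨ +-mono-≤ (weight-lower J (≤-trans (s≤s (≤-trans (m≤m+n t s) (≤-reflexive t+s≡r))) r<ℓ) match′) le ⟩
      ℓ * suc (weight J ℓ q) + ℓ * ∑from (suc q) r f                       ≡⟨ sym (*-distribˡ-+ ℓ (suc (weight J ℓ q)) (∑from (suc q) r f)) ⟩
      ℓ * (suc (weight J ℓ q) + ∑from (suc q) r f)                         ≡⟨ cong (λ w → ℓ * (w + ∑from (suc q) r f)) (sym (*-identityˡ (suc (weight J ℓ q)))) ⟩
      ℓ * (1 * suc (weight J ℓ q) + ∑from (suc q) r f)                     ∎)
      where
      open ≤-Reasoning
      match′ : ∀ i → 1 ≤ i → i < suc t → T (q + i) ≡ T (q + i + ℓ)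
      match′ (suc i) _ (s≤s i<t) = subst (λ w → T w ≡ T (w + ℓ)) (sym (+-suc q i)) (match i i<t)

  record Heavy (n K : ℕ) (ℓm : ℕ × ℕ) : Set where
    constructor heavy
    field
      positive : 1 ≤ proj₁ ℓm
      inside   : proj₂ ℓm + 2 * proj₁ ℓm ≤ suc n
      mismatch : T (proj₂ ℓm) ≢ T (proj₂ ℓm + proj₁ ℓm)
      few      : ∑from (proj₂ ℓm) (proj₁ ℓm) (mis (proj₁ ℓm)) ≤ K

  Heavy? : ∀ n K x → Dec (Heavy n K x)
  Heavy? n K (ℓ , m) = map′ (λ { (a , b , c , d) → heavy a b c d }) (λ { (heavy a b c d) → a , b , c , d })
    ((1 ≤? ℓ) ×-dec (m + 2 * ℓ ≤? suc n) ×-dec ¬? (m ≟ (m + ℓ)) ×-dec (∑from m ℓ (mis ℓ) ≤? K))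

  Base : (n ℓ q : ℕ) → Set
  Base n ℓ q = 1 ≤ ℓ × q + ℓ ≤ n × T q ≢ T (q + ℓ)

  Base? : ∀ n ℓ q → Dec (Base n ℓ q)
  Base? n ℓ q = (1 ≤? ℓ) ×-dec (q + ℓ ≤? n) ×-dec ¬? (q ≟ (q + ℓ))

  module _ (n K J : ℕ) (2K≤2^J : 2 * K ≤ 2 ^ J) where

    V : ℕ → ℕ → ℕ
    V ℓ q = 𝟙 (Base? n ℓ q) * weight J ℓ q

    module _ (ℓ : ℕ) where

      At : ℕ → ℕ → Set
      At m q = Heavy n K (ℓ , m) × m ≤ q × q < m + ℓ

      At? : ∀ m q → Dec (At m q)
      At? m q = Heavy? n K (ℓ , m) ×-dec (m ≤? q) ×-dec (q <? m + ℓ)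

      -- Since `m` is a mismatch, the gaps cover the entire window, so `s = ℓ` in `weights-lower`.
      -- The extra 1 for each mismatch adds up to at most `K`, which is at most half of `2 ^ J`.
      Heavy⇒weights : ∀ m → Heavy n K (ℓ , m) → 2 ^ J ≤ 2 * ∑from m ℓ (λ x → mis ℓ x * weight J ℓ x)
      Heavy⇒weights m (heavy 1≤ℓ _ Tm≢ few) with weights-lower J ℓ ℓ m ≤-refl
      ... | suc t , s , _ , match , _ = ⊥-elim (Tm≢ (subst (λ w → T w ≡ T (w + ℓ)) (+-identityʳ m) (match 0 (s≤s z≤n))))
      ... | zero , s , refl , _ , le = combine (2 ^ J) K (∑from m ℓ (λ x → mis ℓ x * weight J ℓ x)) 2K≤2^J (begin
        2 ^ J                                                    ≤⟨ *-cancelʳ-≤ (2 ^ J) _ ℓ {{>-nonZero 1≤ℓ}} (≤-trans le (≤-reflexive (*-comm ℓ _))) ⟩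
        ∑from m ℓ (λ x → mis ℓ x * suc (weight J ℓ x))            ≡⟨ split ⟩
        ∑from m ℓ (mis ℓ) + ∑from m ℓ (λ x → mis ℓ x * weight J ℓ x)  ≤⟨ +-monoˡ-≤ _ few ⟩
        K + ∑from m ℓ (λ x → mis ℓ x * weight J ℓ x)              ∎)
        where
        open ≤-Reasoning
        split : ∑from m ℓ (λ x → mis ℓ x * suc (weight J ℓ x)) ≡ ∑from m ℓ (mis ℓ) + ∑from m ℓ (λ x → mis ℓ x * weight J ℓ x)
        split = trans (trans (sym (∑≡∑from m ℓ _)) (trans (∑-cong ℓ (λ i → *-suc (mis ℓ (m + i)) (weight J ℓ (m + i)))) (∑≡∑from m ℓ (λ x → mis ℓ x + mis ℓ x * weight J ℓ x))))
          (∑from-+ m ℓ (mis ℓ) (λ x → mis ℓ x * weight J ℓ x))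
        combine : ∀ B K S → 2 * K ≤ B → B ≤ K + S → B ≤ 2 * S
        combine B K S a b = ≤-certificate (2 * K + 2 * B) (B + 2 * (K + S)) 0 (+-mono-≤ a (*-monoʳ-≤ 2 b)) (solve (B ∷ K ∷ S ∷ []))

      charge : ∀ m → 2 ^ J * 𝟙 (Heavy? n K (ℓ , m)) ≤ 2 * ∑ (suc n) (λ q → 𝟙 (At? m q) * V ℓ q)
      charge m with Heavy? n K (ℓ , m)
      ... | no _ = ≤-trans (≤-reflexive (*-zeroʳ (2 ^ J))) z≤n
      ... | yes H = begin
        2 ^ J * 1                                              ≡⟨ *-identityʳ (2 ^ J) ⟩
        2 ^ J                                                  ≤⟨ Heavy⇒weights m H ⟩
        2 * ∑from m ℓ (λ x → mis ℓ x * weight J ℓ x)            ≤⟨ *-monoʳ-≤ 2 (∑from-⊆ z≤n m+ℓ≤ term) ⟩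
        2 * ∑from 0 (suc n) (λ q → 𝟙 (yes H ×-dec (m ≤? q) ×-dec (q <? m + ℓ)) * V ℓ q)
            ≡⟨ cong (2 *_) (sym (∑≡∑from 0 (suc n) (λ q → 𝟙 (yes H ×-dec (m ≤? q) ×-dec (q <? m + ℓ)) * V ℓ q))) ⟩
        2 * ∑ (suc n) (λ q → 𝟙 (yes H ×-dec (m ≤? q) ×-dec (q <? m + ℓ)) * V ℓ q) ∎
        where
        open ≤-Reasoning
        arith : ∀ {m ℓ n} → m + 2 * ℓ ≤ suc n → m + ℓ ≤ suc n
        arith {m} {ℓ} {n} a = ≤-certificate (m + 2 * ℓ) (suc n) ℓ a (solve (m ∷ ℓ ∷ n ∷ []))
        arith′ : ∀ {m ℓ n q} → q < m + ℓ → m + 2 * ℓ ≤ suc n → q + ℓ ≤ n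
        arith′ {m} {ℓ} {n} {q} a b = ≤-certificate (suc q + (m + 2 * ℓ)) (m + ℓ + suc n) 0 (+-mono-≤ a b) (solve (q ∷ m ∷ ℓ ∷ n ∷ []))
        m+ℓ≤ : m + ℓ ≤ suc n
        m+ℓ≤ = arith {m} {ℓ} (Heavy.inside H)
        term : ∀ x → m ≤ x → x < m + ℓ → mis ℓ x * weight J ℓ x ≤ 𝟙 (yes H ×-dec (m ≤? x) ×-dec (x <? m + ℓ)) * V ℓ x
        term x m≤x x<m+ℓ = begin
          mis ℓ x * weight J ℓ x                      ≤⟨ *-monoˡ-≤ (weight J ℓ x) (𝟙-mono (¬? (x ≟ (x + ℓ))) (Base? n ℓ x)
                                                            (λ Tx≢ → Heavy.positive H , arith′ x<m+ℓ (Heavy.inside H) , Tx≢)) ⟩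
          V ℓ x                                      ≡⟨ sym (*-identityˡ (V ℓ x)) ⟩
          1 * V ℓ x                                  ≡⟨ cong (_* V ℓ x) (sym (𝟙-yes (yes H ×-dec (m ≤? x) ×-dec (x <? m + ℓ)) (H , m≤x , x<m+ℓ))) ⟩
          𝟙 (yes H ×-dec (m ≤? x) ×-dec (x <? m + ℓ)) * V ℓ x ∎

      -- All the heavy m whose window contains q are mismatches in the window
      -- of the first of them.
      charged-by-few : ∀ q r s → ∑from s r (λ m → 𝟙 (At? m q)) ≤ K
      charged-by-few q zero    s = z≤n
      charged-by-few q (suc r) s = case At? s q of λ where
          (no ¬at) → ≤-trans (+-monoˡ-≤ _ (≤-reflexive (𝟙-no (At? s q) ¬at))) (charged-by-few q r (suc s))
          (yes (H , _ , q<s+ℓ)) → ≤-trans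
            (∑from-truncate s (suc r) ℓ {g = mis ℓ}
              (λ x → 𝟙-mono (At? x q) (¬? (x ≟ (x + ℓ))) (λ at → Heavy.mismatch (proj₁ at)))
              (λ x s+ℓ≤x → 𝟙-no (At? x q) (λ { (_ , x≤q , _) → <⇒≱ q<s+ℓ (≤-trans s+ℓ≤x x≤q) })))
            (Heavy.few H)

      -- Double counting: after the sums are exchanged, each mismatch `q` pays its weight to at most
      -- `K` windows.
      heavy-row : 2 ^ J * ∑ (suc n) (λ m → 𝟙 (Heavy? n K (ℓ , m))) ≤ 2 * K * ∑ (suc n) (V ℓ)
      heavy-row = begin
        2 ^ J * ∑ (suc n) (λ m → 𝟙 (Heavy? n K (ℓ , m)))                   ≡⟨ sym (∑-*ˡ (suc n) (2 ^ J) (λ m → 𝟙 (Heavy? n K (ℓ , m)))) ⟩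
        ∑ (suc n) (λ m → 2 ^ J * 𝟙 (Heavy? n K (ℓ , m)))                   ≤⟨ ∑-mono (suc n) (λ m _ → charge m) ⟩
        ∑ (suc n) (λ m → 2 * ∑ (suc n) (λ q → 𝟙 (At? m q) * V ℓ q))         ≡⟨ ∑-*ˡ (suc n) 2 (λ m → ∑ (suc n) (λ q → 𝟙 (At? m q) * V ℓ q)) ⟩
        2 * ∑ (suc n) (λ m → ∑ (suc n) (λ q → 𝟙 (At? m q) * V ℓ q))         ≡⟨ cong (2 *_) (∑-swap (suc n) (suc n) (λ m q → 𝟙 (At? m q) * V ℓ q)) ⟩
        2 * ∑ (suc n) (λ q → ∑ (suc n) (λ m → 𝟙 (At? m q) * V ℓ q))         ≤⟨ *-monoʳ-≤ 2 (∑-mono (suc n) (λ q _ → column q)) ⟩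
        2 * ∑ (suc n) (λ q → K * V ℓ q)                                    ≡⟨ cong (2 *_) (∑-*ˡ (suc n) K (V ℓ)) ⟩
        2 * (K * ∑ (suc n) (V ℓ))                                          ≡⟨ sym (*-assoc 2 K _) ⟩
        2 * K * ∑ (suc n) (V ℓ)                                            ∎
        where
        open ≤-Reasoning
        column : ∀ q → ∑ (suc n) (λ m → 𝟙 (At? m q) * V ℓ q) ≤ K * V ℓ q
        column q = begin
          ∑ (suc n) (λ m → 𝟙 (At? m q) * V ℓ q)  ≡⟨ ∑-cong (suc n) (λ m → *-comm (𝟙 (At? m q)) (V ℓ q)) ⟩
          ∑ (suc n) (λ m → V ℓ q * 𝟙 (At? m q))  ≡⟨ ∑-*ˡ (suc n) (V ℓ q) (λ m → 𝟙 (At? m q)) ⟩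
          V ℓ q * ∑ (suc n) (λ m → 𝟙 (At? m q))  ≤⟨ *-monoʳ-≤ (V ℓ q) (≤-trans (≤-reflexive (∑≡∑from 0 (suc n) (λ m → 𝟙 (At? m q)))) (charged-by-few q (suc n) 0)) ⟩
          V ℓ q * K                              ≡⟨ *-comm (V ℓ q) K ⟩
          K * V ℓ q                              ∎

  ∑∑-repeats : ∀ n j → ∑ (suc n) (λ ℓ → ∑ (suc n) (λ q → 𝟙 (Base? n ℓ q) * 𝟙 (Long? (2 ^ j) ℓ q))) ≤ 272 * (2 ^ j * n)
  ∑∑-repeats n j = ≤-trans
    (∑-mono (suc n) (λ ℓ _ → ∑-mono (suc n) (λ q _ → 𝟙-*-≤ (Base? n ℓ q) (Long? (2 ^ j) ℓ q) (Repeat? (2 ^ j) n (ℓ , q))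
      (λ { (a , b , c) d → a , b , c , d }))))
    (∑∑-𝟙-≤ (Repeat? (2 ^ j) n) (suc n) (suc n) (272 * (2 ^ j * n)) (length-repeats (2 ^ j) n (0<2^ j)))

  -- The factor `2 ^ (J ∸ j)` of scale `j` cancels the growth `2 ^ j` of the number of repeats, so
  -- the `suc J` scales contribute equally.
  ∑∑-weight : ∀ n J → ∑ (suc n) (λ ℓ → ∑ (suc n) (λ q → 𝟙 (Base? n ℓ q) * weight J ℓ q)) ≤ 272 * (suc J * (2 ^ J * n))
  ∑∑-weight n zero = ≤-trans (∑∑-repeats n 0) (≤-reflexive (cong (272 *_) (sym (*-identityˡ (1 * n)))))
  ∑∑-weight n (suc J) = begin
    ∑ N (λ ℓ → ∑ N (λ q → b ℓ q * (2 * weight J ℓ q + l ℓ q)))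
        ≡⟨ ∑-cong N (λ ℓ → trans (∑-cong N (λ q → eq (b ℓ q) (weight J ℓ q) (l ℓ q))) (∑-+ N (λ q → 2 * (b ℓ q * weight J ℓ q)) (λ q → b ℓ q * l ℓ q))) ⟩
    ∑ N (λ ℓ → ∑ N (λ q → 2 * (b ℓ q * weight J ℓ q)) + ∑ N (λ q → b ℓ q * l ℓ q))
        ≡⟨ ∑-+ N (λ ℓ → ∑ N (λ q → 2 * (b ℓ q * weight J ℓ q))) (λ ℓ → ∑ N (λ q → b ℓ q * l ℓ q)) ⟩
    ∑ N (λ ℓ → ∑ N (λ q → 2 * (b ℓ q * weight J ℓ q))) + R
        ≡⟨ cong (_+ R) (trans (∑-cong N (λ ℓ → ∑-*ˡ N 2 (λ q → b ℓ q * weight J ℓ q))) (∑-*ˡ N 2 (λ ℓ → ∑ N (λ q → b ℓ q * weight J ℓ q)))) ⟩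
    2 * ∑ N (λ ℓ → ∑ N (λ q → b ℓ q * weight J ℓ q)) + R             ≤⟨ +-mono-≤ (*-monoʳ-≤ 2 (∑∑-weight n J)) (∑∑-repeats n (suc J)) ⟩
    2 * (272 * (suc J * (2 ^ J * n))) + 272 * (2 ^ suc J * n)        ≡⟨ eq′ 272 J (2 ^ J) n ⟩
    272 * (suc (suc J) * (2 ^ suc J * n))                           ∎
    where
    open ≤-Reasoning
    N : ℕ
    N = suc n
    b l : ℕ → ℕ → ℕ
    b ℓ q = 𝟙 (Base? n ℓ q)
    l ℓ q = 𝟙 (Long? (2 ^ suc J) ℓ q)
    R : ℕ
    R = ∑ N (λ ℓ → ∑ N (λ q → b ℓ q * l ℓ q))
    eq : ∀ b w l → b * (2 * w + l) ≡ 2 * (b * w) + b * l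
    eq b w l = solve (b ∷ w ∷ l ∷ [])
    eq′ : ∀ c J P n → 2 * (c * (suc J * (P * n))) + c * (2 * P * n) ≡ c * (suc (suc J) * (2 * P * n))
    eq′ c J P n = solve (c ∷ J ∷ P ∷ n ∷ [])

  Heavy-bounds : ∀ {n K x} → Heavy n K x → proj₁ x < suc n × proj₂ x < suc n × Heavy n K x
  Heavy-bounds {x = ℓ , m} H = arith₁ {ℓ} {m} (Heavy.positive H) (Heavy.inside H) , arith₂ {ℓ} {m} (Heavy.positive H) (Heavy.inside H) , H
    where
    arith₁ : ∀ {ℓ m n} → 1 ≤ ℓ → m + 2 * ℓ ≤ suc n → ℓ < suc n
    arith₁ {ℓ} {m} {n} a b = ≤-certificate (1 + (m + 2 * ℓ)) (ℓ + suc n) m (+-mono-≤ a b) (solve (ℓ ∷ m ∷ n ∷ []))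
    arith₂ : ∀ {ℓ m n} → 1 ≤ ℓ → m + 2 * ℓ ≤ suc n → m < suc n
    arith₂ {ℓ} {m} {n} a b = ≤-certificate (1 + (m + 2 * ℓ)) (ℓ + suc n) ℓ (+-mono-≤ a b) (solve (ℓ ∷ m ∷ n ∷ []))

  -- Both the weight of a window and the total weight carry a factor `2 ^ J`; after cancelling it,
  -- only the number `suc J` of scales remains.
  length-heavy : ∀ n K J → 2 * K ≤ 2 ^ J → (L : List (ℕ × ℕ)) → Unique L → All (Heavy n K) L →
    length L ≤ 544 * (K * (suc J * n))
  length-heavy n K J 2K≤2^J L uniq all = *-cancelˡ-≤ (2 ^ J) {{m^n≢0 2 J}} (begin
    2 ^ J * length L                                                       ≤⟨ *-monoʳ-≤ (2 ^ J) (length≤∑∑-𝟙 (Heavy? n K) N N L uniq (All.map Heavy-bounds all)) ⟩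
    2 ^ J * ∑ N (λ ℓ → ∑ N (λ m → 𝟙 (Heavy? n K (ℓ , m))))                  ≡⟨ sym (∑-*ˡ N (2 ^ J) (λ ℓ → ∑ N (λ m → 𝟙 (Heavy? n K (ℓ , m))))) ⟩
    ∑ N (λ ℓ → 2 ^ J * ∑ N (λ m → 𝟙 (Heavy? n K (ℓ , m))))                  ≤⟨ ∑-mono N (λ ℓ _ → heavy-row n K J 2K≤2^J ℓ) ⟩
    ∑ N (λ ℓ → 2 * K * ∑ N (λ q → 𝟙 (Base? n ℓ q) * weight J ℓ q))          ≡⟨ ∑-*ˡ N (2 * K) (λ ℓ → ∑ N (λ q → 𝟙 (Base? n ℓ q) * weight J ℓ q)) ⟩
    2 * K * ∑ N (λ ℓ → ∑ N (λ q → 𝟙 (Base? n ℓ q) * weight J ℓ q))          ≤⟨ *-monoʳ-≤ (2 * K) (∑∑-weight n J) ⟩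
    2 * K * (272 * (suc J * (2 ^ J * n)))                                  ≡⟨ eq 272 K (suc J) (2 ^ J) n ⟩
    2 ^ J * (544 * (K * (suc J * n)))                                      ∎)
    where
    open ≤-Reasoning
    N : ℕ
    N = suc n
    eq : ∀ c K J P n → 2 * K * (c * (J * (P * n))) ≡ P * (2 * c * (K * (J * n)))
    eq c K J P n = solve (c ∷ K ∷ J ∷ P ∷ n ∷ [])

  abstract

    heavies : (n K : ℕ) → List (ℕ × ℕ)
    heavies n K = filter (Heavy? n K) (cartesianProduct (upTo (suc n)) (upTo (suc n)))

    ∈-heavies : ∀ {n K x} → Heavy n K x → x ∈ heavies n K
    ∈-heavies {n} {K} H = let (ℓ< , m< , _) = Heavy-bounds H in
      ∈-filter⁺ (Heavy? n K) (∈-cartesianProduct⁺ (∈-upTo⁺ ℓ<) (∈-upTo⁺ m<)) H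

    length-heavies : ∀ n K J → 2 * K ≤ 2 ^ J → length (heavies n K) ≤ 544 * (K * (suc J * n))
    length-heavies n K J 2K≤2^J = length-heavy n K J 2K≤2^J (heavies n K)
      (Unique.filter⁺ (Heavy? n K) (Unique.cartesianProduct⁺ (Unique.upTo⁺ (suc n)) (Unique.upTo⁺ (suc n))))
      (all-filter (Heavy? n K) (cartesianProduct (upTo (suc n)) (upTo (suc n))))

-- Uniform runs

𝟙≤1 : {P : Set} (d : Dec P) → 𝟙 d ≤ 1
𝟙≤1 (yes _) = ≤-refl
𝟙≤1 (no _)  = z≤n

-- Turns a sum of indicators into a duplicate-free list, the form in which `AtMost` bounds a set.
-- The map `g` is the identity for the string itself and a reflection for its reversal.
∑from-𝟙-≤ : ∀ {Q P : ℕ → Set} (Q? : ∀ x → Dec (Q x)) (g : ℕ → ℕ) m r {B} →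
  (∀ {x} → m ≤ x → x < m + r → Q x → P (g x)) →
  (∀ {x y} → m ≤ x → x < y → y < m + r → g x ≢ g y) →
  (∀ js → Unique js → All P js → length js ≤ B) → ∑from m r (λ x → 𝟙 (Q? x)) ≤ B
∑from-𝟙-≤ {Q} {P} Q? g m r sound inj bound =
  let (js , uniq , all , len , _) = collect m r sound inj in ≤-trans (≤-reflexive (sym len)) (bound js uniq all)
  where
  collect : ∀ m r → (∀ {x} → m ≤ x → x < m + r → Q x → P (g x)) → (∀ {x y} → m ≤ x → x < y → y < m + r → g x ≢ g y) →
    -- The last component traces every entry back to the range, which separates the next head from
    -- the tail.
    ∃ λ js → Unique js × All P js × length js ≡ ∑from m r (λ x → 𝟙 (Q? x)) × All (λ j → ∃ λ x → m ≤ x × x < m + r × j ≡ g x) js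
  collect m zero sound inj = [] , AllPairs.[] , All.[] , refl , All.[]
  collect m (suc r) sound inj
    with Q? m | collect (suc m) r (λ m<x x< → sound (<⇒≤ m<x) (≤-trans x< (≤-reflexive (sym (+-suc m r)))))
                  (λ m<x x<y y< → inj (<⇒≤ m<x) x<y (≤-trans y< (≤-reflexive (sym (+-suc m r)))))
  ... | no _ | js , uniq , all , len , range = js , uniq , all , len ,
      All.map (λ { (x , m<x , x< , eq) → x , <⇒≤ m<x , ≤-trans x< (≤-reflexive (sym (+-suc m r))) , eq }) range
  ... | yes q | js , uniq , all , len , range = g m ∷ js ,
      All.map (λ { (x , m<x , x< , eq) gm≡j → inj ≤-refl m<x (≤-trans x< (≤-reflexive (sym (+-suc m r)))) (trans gm≡j eq) }) range AllPairs.∷ uniq ,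
      sound ≤-refl (m<m+n m (s≤s z≤n)) q All.∷ all , cong suc len ,
      (m , ≤-refl , m<m+n m (s≤s z≤n) , refl) All.∷
        All.map (λ { (x , m<x , x< , eq) → x , <⇒≤ m<x , ≤-trans x< (≤-reflexive (sym (+-suc m r))) , eq }) range

module UniformRuns {A : Set} (T : ℕ → A) (k n : ℕ) where

  run-fits : ∀ {a b ℓ} → IsUniformRun T k n a b ℓ → a + 2 * ℓ ≤ b
  run-fits {a} {b} {ℓ} (_ , a≤b , _ , 2ℓ≤ , _) = ≤-trans (≤-reflexive (+-comm a (2 * ℓ))) (m≤o∸n⇒m+n≤o (2 * ℓ) a≤b 2ℓ≤)

  run-few : ∀ {a b ℓ} → IsUniformRun T k n a b ℓ → AtMost T k (Mismatch T ℓ a)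
  run-few {a} run@(_ , _ , _ , _ , few , _) = few a ≤-refl (m+n≤o⇒m≤o∸n a (run-fits run))

  -- The longer run, cut off at `suc b`, would extend the shorter one. Hence `a` and `ℓ` determine a
  -- maximal run.
  maximal-end-≮ : ∀ {a b b′ ℓ} → IsMaximalUniformRun T k n a b ℓ → IsMaximalUniformRun T k n a b′ ℓ → ¬ b < b′
  maximal-end-≮ {a} {b} {b′} {ℓ} ((1≤a , a≤b , _ , 2ℓ≤ , _) , _ , maximal) ((_ , _ , b′≤ , _ , few , same) , _) b<b′ =
    maximal (1≤a , m≤n⇒m≤1+n a≤b , ≤-trans b<b′ b′≤ , ≤-trans 2ℓ≤ (∸-monoˡ-≤ a (n≤1+n b)) ,
      (λ i a≤i i≤ → few i a≤i (weaken i≤)) ,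
      (λ i i′ a≤i i≤ a≤i′ i′≤ → same i i′ a≤i (weaken i≤) a≤i′ (weaken i′≤)))
    where
    weaken : ∀ {i} → i ≤ suc b ∸ 2 * ℓ → i ≤ b′ ∸ 2 * ℓ
    weaken i≤ = ≤-trans i≤ (∸-monoˡ-≤ (2 * ℓ) b<b′)

  -- Moving the window from `suc a` to `a` admits position `a` and drops `a + ℓ`. As neither is a
  -- mismatch, the mismatch set stays the same.
  extend-left : ∀ {a b ℓ} → 1 ≤ a → IsUniformRun T k n (suc a) b ℓ →
    T a ≡ T (a + ℓ) → T (a + ℓ) ≡ T (a + ℓ + ℓ) → IsUniformRun T k n a b ℓ
  extend-left {a} {b} {ℓ} 1≤a run@(_ , a<b , b≤ , 2ℓ≤ , few , same) Ta≡ Ta+ℓ≡ =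
    1≤a , <⇒≤ a<b , b≤ , ≤-trans 2ℓ≤ (∸-monoʳ-≤ b (n≤1+n a)) ,
    (λ i a≤i i≤ js uniq all → case m≤n⇒m<n∨m≡n a≤i of λ where
      (inj₁ a<i)  → few i a<i i≤ js uniq all
      (inj₂ refl) → few (suc a) ≤-refl a<e js uniq (All.map shrink all)) ,
    (λ i i′ a≤i i≤ a≤i′ i′≤ j mis → out i′ a≤i′ i′≤ j (into i a≤i i≤ j mis))
    where
    a<e : suc a ≤ b ∸ 2 * ℓ
    a<e = m+n≤o⇒m≤o∸n (suc a) (run-fits run)
    shrink : ∀ {j} → Mismatch T ℓ a j → Mismatch T ℓ (suc a) j
    shrink (a≤j , j< , Tj≢) = case m≤n⇒m<n∨m≡n a≤j of λ where
      (inj₁ a<j)  → a<j , m≤n⇒m≤1+n j< , Tj≢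
      (inj₂ refl) → ⊥-elim (Tj≢ Ta≡)
    widen : ∀ {j} → Mismatch T ℓ (suc a) j → Mismatch T ℓ a j
    widen (a<j , j< , Tj≢) = case m≤n⇒m<n∨m≡n (s≤s⁻¹ j<) of λ where
      (inj₁ j<a+ℓ) → <⇒≤ a<j , j<a+ℓ , Tj≢
      (inj₂ refl)  → ⊥-elim (Tj≢ Ta+ℓ≡)
    into : ∀ i → a ≤ i → i ≤ b ∸ 2 * ℓ → ∀ j → Mismatch T ℓ i j → Mismatch T ℓ (suc a) j
    into i a≤i i≤ j mis = case m≤n⇒m<n∨m≡n a≤i of λ where
      (inj₁ a<i)  → same i (suc a) a<i i≤ ≤-refl a<e j mis
      (inj₂ refl) → shrink mis
    out : ∀ i → a ≤ i → i ≤ b ∸ 2 * ℓ → ∀ j → Mismatch T ℓ (suc a) j → Mismatch T ℓ i j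
    out i a≤i i≤ j mis = case m≤n⇒m<n∨m≡n a≤i of λ where
      (inj₁ a<i)  → same (suc a) i ≤-refl a<e a<i i≤ j mis
      (inj₂ refl) → widen mis

  module _ (_≟_ : ∀ {i j} → i ≤ n → j ≤ n → Dec (T i ≡ T j)) where

    -- Clamping the indices at `n` makes equality of letters decidable at all positions, given only
    -- a decision up to `n`. Reversal exchanges `x` and `suc n ∸ x`.
    forwards backwards : ℕ → A
    forwards  i = T (i ⊓ n)
    backwards i = T ((suc n ∸ i) ⊓ n)

    module F = GappedRepeats forwards (λ i j → m⊓n≤n i n ≟ m⊓n≤n j n)
    module B = GappedRepeats backwards (λ i j → m⊓n≤n (suc n ∸ i) n ≟ m⊓n≤n (suc n ∸ j) n)

    forwards≡ : ∀ {x} → x ≤ n → forwards x ≡ T x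
    forwards≡ x≤n = cong T (m≤n⇒m⊓n≡m x≤n)

    backwards≡ : ∀ x y → x + y ≡ suc n → y ≤ n → backwards x ≡ T y
    backwards≡ x y eq y≤n = cong T (trans (cong (_⊓ n) (trans (cong (_∸ x) (sym eq)) (m+n∸m≡n x y))) (m≤n⇒m⊓n≡m y≤n))

    module _ {a b ℓ} (1≤ℓ : 1 ≤ ℓ) (run : IsUniformRun T k n (suc a) b ℓ) where

      a+2ℓ≤n : a + 2 * ℓ ≤ n
      a+2ℓ≤n = s≤s⁻¹ (≤-trans (run-fits run) (proj₁ (proj₂ (proj₂ run))))

      a+ℓ+ℓ≤n : a + ℓ + ℓ ≤ n
      a+ℓ+ℓ≤n = ≤-certificate (a + 2 * ℓ) n 0 a+2ℓ≤n (solve (a ∷ ℓ ∷ n ∷ []))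

      a+ℓ≤n : a + ℓ ≤ n
      a+ℓ≤n = ≤-trans (m≤m+n (a + ℓ) ℓ) a+ℓ+ℓ≤n

      few-forwards : ∀ r → suc r ≡ ℓ → ∑from a (suc r) (F.mis ℓ) ≤ suc k
      -- Position `a`, just before the run, accounts for the 1; the rest of the window lies within
      -- the first window of the run.
      few-forwards r eq = +-mono-≤ (𝟙≤1 _) (∑from-𝟙-≤ _ id (suc a) r sound (λ _ x<y _ → <⇒≢ x<y) (run-few run))
        where
        bound : ∀ {x} → x < suc a + r → x + ℓ ≤ n
        bound x< = ≤-trans (+-monoˡ-≤ ℓ (≤-trans (<⇒≤ x<) (≤-reflexive (trans (sym (+-suc a r)) (cong (a +_) eq))))) a+ℓ+ℓ≤n
        sound : ∀ {x} → suc a ≤ x → x < suc a + r → forwards x ≢ forwards (x + ℓ) → Mismatch T ℓ (suc a) x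
        sound {x} a<x x< neq = a<x , ≤-trans x< (+-monoʳ-≤ (suc a) (≤-trans (n≤1+n r) (≤-reflexive eq))) ,
          λ Tx≡ → neq (trans (forwards≡ (≤-trans (m≤m+n x ℓ) (bound x<))) (trans Tx≡ (sym (forwards≡ (bound x<)))))

      Heavy-forwards : T a ≢ T (a + ℓ) → F.Heavy n (suc k) (ℓ , a)
      Heavy-forwards Ta≢ = F.heavy 1≤ℓ (m≤n⇒m≤1+n a+2ℓ≤n)
        (λ eq → Ta≢ (trans (sym (forwards≡ (≤-trans (m≤m+n a ℓ) a+ℓ≤n))) (trans eq (forwards≡ a+ℓ≤n))))
        (few 1≤ℓ few-forwards)
        where
        few : ∀ {ℓ′} → 1 ≤ ℓ′ → (∀ r → suc r ≡ ℓ′ → ∑from a (suc r) (F.mis ℓ) ≤ suc k) → ∑from a ℓ′ (F.mis ℓ) ≤ suc k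
        few {suc r} _ h = h r refl

      module _ {m} (m+a+2ℓ≡ : m + (a + 2 * ℓ) ≡ suc n) where

        -- The reflection `x ↦ suc n ∸ (x + ℓ)` maps the window at `m` onto `[a + 1 , a + ℓ]`, which
        -- is the first window of the run, and sends `m` to `a + ℓ`.
        few-backwards : ∑from m ℓ (B.mis ℓ) ≤ k
        few-backwards = ∑from-𝟙-≤ _ (λ x → suc n ∸ (x + ℓ)) m ℓ sound inj (run-few run)
          where
          inside : ∀ {x} → x < m + ℓ → x + ℓ ≤ suc n
          inside {x} x< = ≤-trans (+-monoˡ-≤ ℓ (<⇒≤ x<)) (≤-trans (lemma m ℓ a) (≤-reflexive m+a+2ℓ≡))
            where
            lemma : ∀ m ℓ a → m + ℓ + ℓ ≤ m + (a + 2 * ℓ)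
            lemma m ℓ a = ≤-certificate 0 a 0 z≤n (solve (m ∷ ℓ ∷ a ∷ []))
          inj : ∀ {x y} → m ≤ x → x < y → y < m + ℓ → suc n ∸ (x + ℓ) ≢ suc n ∸ (y + ℓ)
          inj {x} {y} _ x<y y< eq = <⇒≢ x<y (+-cancelʳ-≡ ℓ x y (∸-cancelˡ-≡ (inside (≤-trans x<y (<⇒≤ y<))) (inside y<) eq))
          sound′ : ∀ {x} y → y + (x + ℓ) ≡ suc n → m ≤ x → x < m + ℓ → backwards x ≢ backwards (x + ℓ) → Mismatch T ℓ (suc a) y
          sound′ {x} y y+x+ℓ≡ m≤x x< neq =
              lower (≤-reflexive (trans m+a+2ℓ≡ (sym y+x+ℓ≡))) x<
            , upper (≤-reflexive (trans y+x+ℓ≡ (sym m+a+2ℓ≡))) m≤x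
            , λ Ty≡ → neq (trans (backwards≡ x (y + ℓ) x+[y+ℓ]≡ y+ℓ≤n) (trans (sym Ty≡) (sym (backwards≡ (x + ℓ) y (trans (+-comm (x + ℓ) y) y+x+ℓ≡) (≤-trans (m≤m+n y ℓ) y+ℓ≤n)))))
            where
            lower : m + (a + 2 * ℓ) ≤ y + (x + ℓ) → x < m + ℓ → suc a ≤ y
            lower p q = ≤-certificate (m + (a + 2 * ℓ) + suc x) (y + (x + ℓ) + (m + ℓ)) 0 (+-mono-≤ p q) (solve (m ∷ a ∷ ℓ ∷ x ∷ y ∷ []))
            upper : y + (x + ℓ) ≤ m + (a + 2 * ℓ) → m ≤ x → y < suc a + ℓ
            upper p q = ≤-certificate (y + (x + ℓ) + m) (m + (a + 2 * ℓ) + x) 0 (+-mono-≤ p q) (solve (m ∷ a ∷ ℓ ∷ x ∷ y ∷ []))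
            x+[y+ℓ]≡ : x + (y + ℓ) ≡ suc n
            x+[y+ℓ]≡ = trans {j = y + (x + ℓ)} (solve (x ∷ y ∷ ℓ ∷ [])) y+x+ℓ≡
            y+ℓ≤n : y + ℓ ≤ n
            y+ℓ≤n = arith (≤-reflexive y+x+ℓ≡) (≤-reflexive (sym m+a+2ℓ≡)) m≤x a+2ℓ≤n
              where
              arith : y + (x + ℓ) ≤ suc n → suc n ≤ m + (a + 2 * ℓ) → m ≤ x → a + 2 * ℓ ≤ n → y + ℓ ≤ n
              arith p q r s = ≤-certificate (y + (x + ℓ) + (suc n + (m + (a + 2 * ℓ)))) (suc n + (m + (a + 2 * ℓ) + (x + n))) 0 (+-mono-≤ p (+-mono-≤ q (+-mono-≤ r s)))
                  (solve (m ∷ a ∷ ℓ ∷ x ∷ y ∷ n ∷ []))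
          sound : ∀ {x} → m ≤ x → x < m + ℓ → backwards x ≢ backwards (x + ℓ) → Mismatch T ℓ (suc a) (suc n ∸ (x + ℓ))
          sound {x} m≤x x< = sound′ (suc n ∸ (x + ℓ)) (m∸n+n≡m (inside x<)) m≤x x<

        Heavy-backwards : T (a + ℓ) ≢ T (a + ℓ + ℓ) → B.Heavy n (suc k) (ℓ , m)
        Heavy-backwards neq = B.heavy 1≤ℓ (≤-trans (+-monoʳ-≤ m (m≤n+m (2 * ℓ) a)) (≤-reflexive m+a+2ℓ≡))
          (λ eq → neq (trans (sym (backwards≡ (m + ℓ) (a + ℓ) eq₁ a+ℓ≤n)) (trans (sym eq) (backwards≡ m (a + ℓ + ℓ) eq₂ a+ℓ+ℓ≤n))))
          (m≤n⇒m≤1+n few-backwards)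
          where
          eq₁ : m + ℓ + (a + ℓ) ≡ suc n
          eq₁ = trans {j = m + (a + 2 * ℓ)} (solve (m ∷ ℓ ∷ a ∷ [])) m+a+2ℓ≡
          eq₂ : m + (a + ℓ + ℓ) ≡ suc n
          eq₂ = trans {j = m + (a + 2 * ℓ)} (solve (m ∷ ℓ ∷ a ∷ [])) m+a+2ℓ≡

    -- The end `b` is omitted because maximality determines it. For `a = 1` the code is the
    -- predecessor of the period, so that it ranges over `upTo n`.
    data Origin : ℕ × ℕ × ℕ → ℕ ⊎ (ℕ × ℕ) ⊎ (ℕ × ℕ) → Set where
      first : ∀ {b ℓ} → Origin (1 , b , suc ℓ) (inj₁ ℓ)
      outer : ∀ {a b ℓ} → Origin (suc a , b , ℓ) (inj₂ (inj₁ (ℓ , a)))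
      inner : ∀ {a b ℓ m} → m + (a + 2 * ℓ) ≡ suc n → Origin (suc a , b , ℓ) (inj₂ (inj₂ (ℓ , m)))

    Origin-injective : ∀ {x x′ y} → Counted T k n x × Origin x y → Counted T k n x′ × Origin x′ y → x ≡ x′
    Origin-injective {x} {x′} (C , o) (C′ , o′) = finish C C′ (start o o′)
      where
      start : ∀ {a b ℓ a′ b′ ℓ′ y} → Origin (a , b , ℓ) y → Origin (a′ , b′ , ℓ′) y → a ≡ a′ × ℓ ≡ ℓ′
      start first first = refl , refl
      start outer outer = refl , refl
      start {ℓ = ℓ} (inner {a} {m = m} eq) (inner {a′} eq′) =
        cong suc (+-cancelʳ-≡ (2 * ℓ) a a′ (+-cancelˡ-≡ m (a + 2 * ℓ) (a′ + 2 * ℓ) (trans eq (sym eq′)))) , refl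
      finish : ∀ {a b ℓ a′ b′ ℓ′} → Counted T k n (a , b , ℓ) → Counted T k n (a′ , b′ , ℓ′) → a ≡ a′ × ℓ ≡ ℓ′ → (a , b , ℓ) ≡ (a′ , b′ , ℓ′)
      finish (_ , _ , M) (_ , _ , M′) (refl , refl)
        with ≤-antisym (≮⇒≥ (maximal-end-≮ M′ M)) (≮⇒≥ (maximal-end-≮ M M′))
      ... | refl = refl

    origins : List (ℕ ⊎ (ℕ × ℕ) ⊎ (ℕ × ℕ))
    origins = map inj₁ (upTo n) ++ (map (inj₂ ∘ inj₁) (F.heavies n (suc k)) ++ map (inj₂ ∘ inj₂) (B.heavies n (suc k)))

    ∈-first : ∀ {ℓ} → ℓ ∈ upTo n → inj₁ ℓ ∈ origins
    ∈-first ℓ∈ = ∈-++⁺ˡ (∈-map⁺ inj₁ ℓ∈)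

    ∈-outer : ∀ {x} → F.Heavy n (suc k) x → inj₂ (inj₁ x) ∈ origins
    ∈-outer H = ∈-++⁺ʳ (map inj₁ (upTo n)) (∈-++⁺ˡ (∈-map⁺ (inj₂ ∘ inj₁) (F.∈-heavies H)))

    ∈-inner : ∀ {x} → B.Heavy n (suc k) x → inj₂ (inj₂ x) ∈ origins
    ∈-inner H = ∈-++⁺ʳ (map inj₁ (upTo n)) (∈-++⁺ʳ (map (inj₂ ∘ inj₁) (F.heavies n (suc k))) (∈-map⁺ (inj₂ ∘ inj₂) (B.∈-heavies H)))

    module _ {a b ℓ} (1≤ℓ : 1 ≤ ℓ) (run : IsUniformRun T k n (suc (suc a)) b ℓ) (¬left : ¬ IsUniformRun T k n (suc a) b ℓ) where

      run-origin : ∃ λ y → y ∈ origins × Origin (suc (suc a) , b , ℓ) y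
      run-origin = compare (a≤n ≟ a+ℓ≤n 1≤ℓ run) (a+ℓ≤n 1≤ℓ run ≟ a+ℓ+ℓ≤n 1≤ℓ run)
        where
        a≤n : suc a ≤ n
        a≤n = ≤-trans (m≤m+n (suc a) ℓ) (a+ℓ≤n 1≤ℓ run)
        m+≡ : suc n ∸ (suc a + 2 * ℓ) + (suc a + 2 * ℓ) ≡ suc n
        m+≡ = m∸n+n≡m (m≤n⇒m≤1+n (a+2ℓ≤n 1≤ℓ run))
        compare : Dec (T (suc a) ≡ T (suc a + ℓ)) → Dec (T (suc a + ℓ) ≡ T (suc a + ℓ + ℓ)) →
          ∃ λ y → y ∈ origins × Origin (suc (suc a) , b , ℓ) y
        compare (no Ta≢)  _            = inj₂ (inj₁ (ℓ , suc a)) , ∈-outer (Heavy-forwards 1≤ℓ run Ta≢) , outer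
        compare (yes _)   (no Ta+ℓ≢)   = inj₂ (inj₂ (ℓ , suc n ∸ (suc a + 2 * ℓ))) , ∈-inner (Heavy-backwards 1≤ℓ run m+≡ Ta+ℓ≢) , inner m+≡
        compare (yes Ta≡) (yes Ta+ℓ≡)  = ⊥-elim (¬left (extend-left (s≤s z≤n) run Ta≡ Ta+ℓ≡))

    Counted⇒origin : ∀ {a b ℓ} → Counted T k n (a , b , ℓ) → ∃ λ y → y ∈ origins × Origin (a , b , ℓ) y
    Counted⇒origin {zero} (_ , _ , (() , _) , _)
    Counted⇒origin {suc zero} {ℓ = suc ℓ} (_ , _ , run , _) =
      inj₁ ℓ , ∈-first (∈-upTo⁺ (≤-trans (m≤m+n (suc ℓ) (suc ℓ + 0)) (a+2ℓ≤n (s≤s z≤n) run))) , first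
    Counted⇒origin {suc (suc a)} (1≤ℓ , _ , run , ¬left , _) = run-origin 1≤ℓ run ¬left

    length-origins : ∀ J → 2 * suc k ≤ 2 ^ J → length origins ≤ n + (544 * (suc k * (suc J * n)) + 544 * (suc k * (suc J * n)))
    length-origins J le = begin
      length origins                     ≡⟨ length-++ (map inj₁ (upTo n)) ⟩
      length (map inj₁ (upTo n)) + length (fs ++ bs)  ≡⟨ cong₂ _+_ (trans (length-map inj₁ (upTo n)) (length-applyUpTo id n)) (length-++ fs) ⟩
      n + (length fs + length bs)        ≡⟨ cong₂ (λ x y → n + (x + y)) (length-map (inj₂ ∘ inj₁) (F.heavies n (suc k))) (length-map (inj₂ ∘ inj₂) (B.heavies n (suc k))) ⟩
      n + (length (F.heavies n (suc k)) + length (B.heavies n (suc k)))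
          ≤⟨ +-monoʳ-≤ n (+-mono-≤ (F.length-heavies n (suc k) J le) (B.length-heavies n (suc k) J le)) ⟩
      n + (544 * (suc k * (suc J * n)) + 544 * (suc k * (suc J * n)))    ∎
      where
      open ≤-Reasoning
      fs bs : List (ℕ ⊎ (ℕ × ℕ) ⊎ (ℕ × ℕ))
      fs = map (inj₂ ∘ inj₁) (F.heavies n (suc k))
      bs = map (inj₂ ∘ inj₂) (B.heavies n (suc k))

    length-runs : ∀ J → 2 * suc k ≤ 2 ^ J → (L : List (ℕ × ℕ × ℕ)) → Unique L → All (Counted T k n) L →
      length L ≤ n + (544 * (suc k * (suc J * n)) + 544 * (suc k * (suc J * n)))
    length-runs J le L uniq all = ≤-trans
      (Unique⇒length≤ (λ x y → Counted T k n x × Origin x y) Origin-injective L uniq origins (λ x∈L →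
        let C = All.lookup all x∈L ; (y , y∈ , o) = Counted⇒origin C in y , y∈ , C , o))
      (length-origins J le)

-- Arbitrary alphabets and the final constant

¬¬-all-< : ∀ n {P : ℕ → Set} → (∀ i → ¬ ¬ P i) → ¬ ¬ (∀ {i} → i < n → P i)
¬¬-all-< zero    ¬¬P ¬all = ¬all λ ()
¬¬-all-< (suc n) ¬¬P ¬all = ¬¬-all-< n ¬¬P λ all → ¬¬P n λ Pn → ¬all λ {i} i<1+n →
  case m≤n⇒m<n∨m≡n (s≤s⁻¹ i<1+n) of λ where
    (inj₁ i<n)  → all i<n
    (inj₂ refl) → Pn

k<2^[1+log₂k] : ∀ k → k < 2 ^ suc ⌊log₂ k ⌋
k<2^[1+log₂k] k = ≰⇒> λ le → 1+n≰n (≤-trans (≤-reflexive (sym (⌊log₂[2^n]⌋≡n (suc ⌊log₂ k ⌋)))) (⌊log₂⌋-mono-≤ le))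

-- Here `l` is `logFactor k` and `suc (suc l)` is `J + 1`. By `k + 1 ≤ 2k` and `l + 2 ≤ 3l`, each of
-- the two directions costs a factor 6.
final-bound : ∀ c n k l → 1 ≤ k → 1 ≤ l →
  n + (c * (suc k * (suc (suc l) * n)) + c * (suc k * (suc (suc l) * n))) ≤ (1 + 12 * c) * n * k * l
final-bound c n k l 1≤k 1≤l = begin
  n + (c * (suc k * (suc (suc l) * n)) + c * (suc k * (suc (suc l) * n)))  ≤⟨ +-mono-≤ n≤ (+-mono-≤ half half) ⟩
  n * (k * l) + (c * (6 * (n * (k * l))) + c * (6 * (n * (k * l))))        ≡⟨ solve (c ∷ n ∷ k ∷ l ∷ []) ⟩
  (1 + 12 * c) * n * k * l                                                 ∎
  where
  open ≤-Reasoning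
  n≤ : n ≤ n * (k * l)
  n≤ = ≤-trans (≤-reflexive (sym (*-identityʳ n))) (*-monoʳ-≤ n (*-mono-≤ 1≤k 1≤l))
  2+l≤3l : suc (suc l) ≤ 3 * l
  2+l≤3l = ≤-certificate (1 + 1) (l + l) 0 (+-mono-≤ 1≤l 1≤l) (solve (l ∷ []))
  1+k≤2k : suc k ≤ 2 * k
  1+k≤2k = ≤-certificate 1 k 0 1≤k (solve (k ∷ []))
  eq : 2 * k * (3 * l * n) ≡ 6 * (n * (k * l))
  eq = solve (n ∷ k ∷ l ∷ [])
  half : c * (suc k * (suc (suc l) * n)) ≤ c * (6 * (n * (k * l)))
  half = *-monoʳ-≤ c (≤-trans (*-mono-≤ 1+k≤2k (*-monoˡ-≤ n 2+l≤3l)) (≤-reflexive eq))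

theorem12 : Σ ℕ λ C → (A : Set) (k n : ℕ) → 1 ≤ k → (T : ℕ → A) →
    (L : List (ℕ × ℕ × ℕ)) → Unique L → All (Counted T k n) L →
    length L ≤ C * n * k * logFactor k
theorem12 = 1 + 12 * 544 , λ A k n 1≤k T L uniq all →
  -- Equality on `A` need not be decidable. But the bound is a decidable statement, hence stable
  -- under double negation, and under a double negation the finitely many equalities of letters at
  -- positions up to `n` can all be decided.
  decidable-stable (_ ≤? _) λ ¬bound →
    ¬¬-all-< (suc n) {λ i → ∀ {j} → j < suc n → Dec (T i ≡ T j)} (λ i → ¬¬-all-< (suc n) (λ j → ¬¬-excluded-middle)) λ dec →
      ¬bound (≤-trans
        -- `J` is one more than `logFactor k`, because `k + 1 ≤ 2 ^ logFactor k` gets doubled.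
        (UniformRuns.length-runs T k n (λ i≤n j≤n → dec (s≤s i≤n) (s≤s j≤n)) (suc (logFactor k)) (*-monoʳ-≤ 2 (k<2^[1+log₂k] k)) L uniq all)
        (final-bound 544 n k (logFactor k) 1≤k (s≤s z≤n)))
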